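{- Let $n$ be a positive integer and let $x,y,z$ be complex numbers with $x+y+z=1$. (i) If $r,s,t$ are complex numbers with $r+s+t=n-1$, then $$\sum_{k=0}^n(-1)^k\binom rk\binom s{n-k}B_k(x)E_{n-k}(z)-(-1)^n\sum_{k=0}^n(-1)^k\binom rk\binom t{n-k}B_k(y)E_{n-k}(z)=\frac r2\sum_{l=0}^{n-1}(-1)^l\binom sl\binom t{n-1-l}E_l(y)E_{n-1-l}(x).$$ (ii) If $r,s,t$ are complex numbers with $r+s+t=n$, then $$r\,M_n(s,t;x,y)+s\,M_n(t,r;y,z)+t\,M_n(r,s;z,x)=0,$$ where for complex $a,b,u,v$ we put $$M_n(a,b;u,v):=\sum_{k=0}^n(-1)^k\binom ak\binom b{n-k}B_{n-k}(u)B_k(v).$$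
   Context: Bernoulli numbers: $B_0=1$ and $\sum_{k=0}^n\binom{n+1}kB_k=0$ for $n\ge1$. Euler numbers: $E_0=1$ and $\sum_{0\le k\le n,\ 2\mid n-k}\binom nkE_k=0$ for $n\ge1$. Bernoulli polynomials $B_n(x)=\sum_{k=0}^n\binom nkB_kx^{n-k}$; Euler polynomials $E_n(x)=\sum_{k=0}^n\binom nk\frac{E_k}{2^k}(x-\tfrac12)^{n-k}$. For complex $z$ and integer $k\ge0$, $\binom zk=z(z-1)\cdots(z-k+1)/k!$ (with $\binom z0=1$). -}

module Defs where

open import Level using (Level)
open import Data.Nat as ℕ using (ℕ; zero; suc; _∸_; _≡ᵇ_)
open import Data.Nat.Combinatorics using (_C_)
open import Data.Bool using (Bool; true; false; if_then_else_)
open import Data.Integer using (+_; -[1+_])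
open import Data.Rational as ℚ using (ℚ; 0ℚ; 1ℚ)
open import Data.Rational.Properties using (+-*-commutativeRing)
open import Algebra.Bundles using (CommutativeRing)
open import Algebra.Morphism.Structures using (module RingMorphisms)

ℕ→ℚ : ℕ → ℚ
ℕ→ℚ n = + n ℚ./ 1

Σℚ : ℕ → (ℕ → ℚ) → ℚ
Σℚ zero    f = 0ℚ
Σℚ (suc n) f = Σℚ n f ℚ.+ f n

-- Given a table containing B_0,…,B_{m-1}, the defining recurrence
-- Σ_{k=0}^{m} C(m+1,k) B_k = 0  (m ≥ 1) gives
-- B_m = - (1/(m+1)) Σ_{k<m} C(m+1,k) B_k.
nextB : (ℕ → ℚ) → ℕ → ℚ
nextB tb m = ℚ.- ((+ 1 ℚ./ suc m) ℚ.* Σℚ m (λ k → ℕ→ℚ (suc m C k) ℚ.* tb k))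

-- tableB m k = B_k for k ≤ m
tableB : ℕ → ℕ → ℚ
tableB zero    _ = 1ℚ
tableB (suc m) k = if k ≡ᵇ suc m then nextB (tableB m) (suc m) else tableB m k

Bnum : ℕ → ℚ
Bnum n = tableB n n

even? : ℕ → Bool
even? zero          = true
even? (suc zero)    = false
even? (suc (suc n)) = even? n

-- From the recurrence Σ_{0≤k≤m, 2∣m-k} C(m,k) E_k = 0 (m ≥ 1):
-- E_m = - Σ_{k<m, 2∣m-k} C(m,k) E_k.
nextE : (ℕ → ℚ) → ℕ → ℚ
nextE te m = ℚ.- Σℚ m (λ k → if even? (m ∸ k) then ℕ→ℚ (m C k) ℚ.* te k else 0ℚ)

tableE : ℕ → ℕ → ℚ
tableE zero    _ = 1ℚ
tableE (suc m) k = if k ≡ᵇ suc m then nextE (tableE m) (suc m) else tableE m k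

Enum : ℕ → ℚ
Enum n = tableE n n

invPow2 : ℕ → ℚ
invPow2 zero    = 1ℚ
invPow2 (suc k) = invPow2 k ℚ.* (+ 1 ℚ./ 2)

invFact : ℕ → ℚ
invFact zero    = 1ℚ
invFact (suc k) = invFact k ℚ.* (+ 1 ℚ./ suc k)

-- A commutative ring R together with a ring homomorphism ℚ → R
-- (i.e. a ℚ-algebra; ℂ is the case of the paper).

IsQHom : ∀ {c ℓ} (R : CommutativeRing c ℓ) → (ℚ → CommutativeRing.Carrier R) → Set _
IsQHom R ι = RingMorphisms.IsRingHomomorphism
               (CommutativeRing.rawRing +-*-commutativeRing)
               (CommutativeRing.rawRing R) ι

module _ {c ℓ} (R : CommutativeRing c ℓ) (ι : ℚ → CommutativeRing.Carrier R) where
  open CommutativeRing R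

  Σ< : ℕ → (ℕ → Carrier) → Carrier
  Σ< zero    f = 0#
  Σ< (suc n) f = Σ< n f + f n

  pow : Carrier → ℕ → Carrier
  pow x zero    = 1#
  pow x (suc k) = pow x k * x

  sgn : ℕ → Carrier
  sgn zero    = 1#
  sgn (suc k) = - sgn k

  falling : Carrier → ℕ → Carrier
  falling z zero    = 1#
  falling z (suc k) = falling z k * (z - ι (ℕ→ℚ k))

  binom : Carrier → ℕ → Carrier
  binom z k = falling z k * ι (invFact k)

  Bpoly : ℕ → Carrier → Carrier
  Bpoly n x = Σ< (suc n) (λ k → ι (ℕ→ℚ (n C k) ℚ.* Bnum k) * pow x (n ∸ k))

  Epoly : ℕ → Carrier → Carrier
  Epoly n x = Σ< (suc n) (λ k →
    ι (ℕ→ℚ (n C k) ℚ.* (Enum k ℚ.* invPow2 k)) * pow (x - ι (+ 1 ℚ./ 2)) (n ∸ k))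

  M : ℕ → Carrier → Carrier → Carrier → Carrier → Carrier
  M n a b u v = Σ< (suc n) (λ k →
    sgn k * binom a k * binom b (n ∸ k) * Bpoly (n ∸ k) u * Bpoly k v)

{-# OPTIONS --safe #-}
module Submission where

-- Homogenise: replace the variable w of a generating function by a w, for a in a polynomial ring with elements
-- u and γ, and put v = u + γ.  Write β(a) for the series of the Bernoulli numbers, η(a) for that of the Euler
-- numbers at a / 2, and e(a) = exp(a w), so that B(x, a) = β(a) e(x a) and E(x, a) = η(a) e((x - ½) a) generate
-- B_n(x) a^n / n! and E_n(x) a^n / n!.  For x + y + z = 1, addition of exponents gives
--   B(x, -γ) E(z, -v) = B(y, γ) E(z, -u) + ½ γ w E(y, v) E(x, u),
--   γ B(y, v) B(x, u) + u B(x, -γ) B(z, -v) = v B(z, -u) B(y, γ).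
-- Writing ⟨a⟩_k for the falling factorial, let L be the linear functional on forms of degree r + s + t + 1 with
-- L(γ^k u^j) = ⟨r⟩_k ⟨t⟩_j.  As v = u + γ, induction on m gives
--   L(γ^k v^m u^j) = (-1)^m ⟨r⟩_k ⟨s⟩_m ⟨t⟩_j,
-- and applying L to the coefficient of w^n in the two relations gives (i) and (ii).

open import Defs
open import Level using (0ℓ)
open import Data.Bool using (true; false; if_then_else_)
open import Data.Nat as ℕ using (ℕ; zero; suc; _∸_; _≤_; z≤n; s≤s; _≡ᵇ_; _!)
import Data.Nat.Properties as ℕP
open import Data.Nat.Combinatorics using (_C_; nCk≡n!/k![n-k]!; k![n∸k]!∣n!; nC1≡n; nCk≡nC[n∸k]; nCn≡1)
open import Data.Nat.DivMod using (m/n*n≡m)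
open import Data.Integer as ℤ using (+_)
import Data.Integer.Properties as ℤP
open import Data.Rational as ℚ using (ℚ; 0ℚ; 1ℚ; ½)
import Data.Rational.Properties as ℚP
import Data.Rational.Unnormalised as ℚᵘ
import Data.Rational.Unnormalised.Properties as ℚᵘP
open import Data.Maybe using (Maybe; just; nothing)
open import Data.Product using (_×_; _,_)
open import Algebra.Bundles using (CommutativeRing)
open import Algebra.Morphism.Structures using (module RingMorphisms)
import Algebra.Morphism.Construct.Composition
import Algebra.Morphism.Construct.Identity
import Algebra.Solver.Ring
open import Algebra.Solver.Ring.AlmostCommutativeRing using (fromCommutativeRing; _-Raw-AlmostCommutative⟶_)
open import Function using (id; _∘_)
open import Relation.Nullary using (yes; no)
open import Relation.Binary.PropositionalEquality as ≡ using (_≡_)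
import Relation.Binary.Reasoning.Setoid

-- Falling factorials are not multiplicative in the exponent, so no choice of values for γ, v, u
-- turns their powers into ⟨r⟩_k, ⟨s⟩_m, ⟨t⟩_j. A map that is merely linear can do so, provided that
-- it respects v = u + γ, and fixing r + s + t is what secures this. The relations need products of
-- series, so L can act only after a coefficient of w has been extracted. The degree r + s + t + 1
-- suits both parts. In (i) the coefficient of w^n has degree n = r + s + t + 1; in (ii) it has
-- degree n = r + s + t, and the outer factor γ, u or v supplies the missing one. The base is an
-- arbitrary ℚ-algebra, possibly with zero divisors, so a quotient such as a w / (e(a) - 1) is never
-- formed. It is replaced by a pair of series whose product is 1, and the only non-unit ever
-- cancelled is the variable w.

ℚring : CommutativeRing 0ℓ 0ℓ
ℚring = ℚP.+-*-commutativeRing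

module QAlgebra {c ℓ} (R : CommutativeRing c ℓ) (ι : ℚ → CommutativeRing.Carrier R) (ι-hom : IsQHom R ι) where
  open CommutativeRing R public hiding (zero)
  open RingMorphisms.IsRingHomomorphism ι-hom public
    using () renaming (+-homo to ι-+; *-homo to ι-*; -‿homo to ι-neg; 0#-homo to ι-0; 1#-homo to ι-1)
  module Reason = Relation.Binary.Reasoning.Setoid setoid

  ι-≡ : ∀ {p q} → p ≡ q → ι p ≈ ι q
  ι-≡ ≡.refl = refl

  private
    morphism : CommutativeRing.rawRing ℚring -Raw-AlmostCommutative⟶ fromCommutativeRing R
    morphism = record
      { ⟦_⟧ = ι ; +-homo = ι-+ ; *-homo = ι-* ; -‿homo = ι-neg ; 0-homo = ι-0 ; 1-homo = ι-1 }

    ≈? : (p q : ℚ) → Maybe (ι p ≈ ι q)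
    ≈? p q with p ℚP.≟ q
    ... | yes p≡q = just (ι-≡ p≡q)
    ... | no  _   = nothing

  open Algebra.Solver.Ring (CommutativeRing.rawRing ℚring) (fromCommutativeRing R) morphism ≈? public
    using (solve; con; _:+_; _:*_; _:-_; :-_; _:^_; _:=_; Polynomial)

  -- con 1ℚ denotes ι 1ℚ, whereas a zeroth power denotes 1# itself.
  :1 : ∀ {n} → Polynomial n
  :1 = con 1ℚ :^ 0

-- Formal power series over a commutative ring, and finite sums.

module PowerSeries {c ℓ} (R : CommutativeRing c ℓ) where
  open CommutativeRing R hiding (zero; ring)
  private
    module Reason = Relation.Binary.Reasoning.Setoid setoid
  open import Algebra.Properties.CommutativeSemigroup +-commutativeSemigroup using (interchange)

  Series : Set c
  Series = ℕ → Carrier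

  infix 4 _≋_
  record _≋_ (f g : Series) : Set ℓ where
    constructor coefficientwise
    field at : ∀ n → f n ≈ g n
  open _≋_ public

  tail : Series → Series
  tail f n = f (suc n)

  infixl 6 _⊕_
  _⊕_ : Series → Series → Series
  (f ⊕ g) n = f n + g n

  infixl 7 _⊛_ _·_
  _·_ : Carrier → Series → Series
  (a · f) n = a * f n

  -- The Cauchy product, by f g = f(0) g + w (tail f) g. The ring laws then follow by induction on
  -- the index, without reindexing double sums.
  _⊛_ : Series → Series → Series
  (f ⊛ g) zero    = f zero * g zero
  (f ⊛ g) (suc n) = f zero * g (suc n) + (tail f ⊛ g) n

  ⊛-cong-at : ∀ {f f′ g g′} → (∀ n → f n ≈ f′ n) → (∀ n → g n ≈ g′ n) → ∀ n → (f ⊛ g) n ≈ (f′ ⊛ g′) n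
  ⊛-cong-at p q zero    = *-cong (p 0) (q 0)
  ⊛-cong-at p q (suc n) = +-cong (*-cong (p 0) (q (suc n))) (⊛-cong-at (λ k → p (suc k)) q n)

  ⊛-distribʳ-at : ∀ h f g n → ((f ⊕ g) ⊛ h) n ≈ (f ⊛ h) n + (g ⊛ h) n
  ⊛-distribʳ-at h f g zero    = distribʳ _ _ _
  ⊛-distribʳ-at h f g (suc n) =
    trans (+-cong (distribʳ _ _ _) (⊛-distribʳ-at h (tail f) (tail g) n)) (interchange _ _ _ _)

  ·-⊛-at : ∀ a f g n → ((a · f) ⊛ g) n ≈ a * (f ⊛ g) n
  ·-⊛-at a f g zero    = *-assoc _ _ _
  ·-⊛-at a f g (suc n) =
    trans (+-cong (*-assoc _ _ _) (·-⊛-at a (tail f) g n)) (sym (distribˡ _ _ _))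

  -- The mirror image of the defining recursion: here the right factor is split as g(0) + w (tail
  -- g). Commutativity rests on comparing the two.
  ⊛-last : ∀ f g n → (f ⊛ g) (suc n) ≈ (f ⊛ tail g) n + f (suc n) * g 0
  ⊛-last f g zero    = refl
  ⊛-last f g (suc n) = trans (+-congˡ (⊛-last (tail f) g n)) (sym (+-assoc _ _ _))

  ⊛-comm-at : ∀ f g n → (f ⊛ g) n ≈ (g ⊛ f) n
  ⊛-comm-at f g zero    = *-comm _ _
  ⊛-comm-at f g (suc n) = begin
    f 0 * g (suc n) + (tail f ⊛ g) n  ≈⟨ +-cong (*-comm _ _) (⊛-comm-at (tail f) g n) ⟩
    g (suc n) * f 0 + (g ⊛ tail f) n  ≈⟨ +-comm _ _ ⟩
    (g ⊛ tail f) n + g (suc n) * f 0  ≈⟨ ⊛-last g f n ⟨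
    (g ⊛ f) (suc n)                   ∎
    where open Reason

  ⊛-assoc-at : ∀ f g h n → ((f ⊛ g) ⊛ h) n ≈ (f ⊛ (g ⊛ h)) n
  ⊛-assoc-at f g h zero    = *-assoc _ _ _
  ⊛-assoc-at f g h (suc n) = begin
    (f 0 * g 0) * h (suc n) + ((f 0 · tail g ⊕ tail f ⊛ g) ⊛ h) n
      ≈⟨ +-cong (*-assoc _ _ _) (⊛-distribʳ-at h (f 0 · tail g) (tail f ⊛ g) n) ⟩
    f 0 * (g 0 * h (suc n)) + (((f 0 · tail g) ⊛ h) n + ((tail f ⊛ g) ⊛ h) n)
      ≈⟨ +-congˡ (+-cong (·-⊛-at (f 0) (tail g) h n) (⊛-assoc-at (tail f) g h n)) ⟩
    f 0 * (g 0 * h (suc n)) + (f 0 * (tail g ⊛ h) n + (tail f ⊛ (g ⊛ h)) n)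
      ≈⟨ +-assoc _ _ _ ⟨
    (f 0 * (g 0 * h (suc n)) + f 0 * (tail g ⊛ h) n) + (tail f ⊛ (g ⊛ h)) n
      ≈⟨ +-congʳ (distribˡ _ _ _) ⟨
    (f ⊛ (g ⊛ h)) (suc n) ∎
    where open Reason

  const : Carrier → Series
  const a zero    = a
  const a (suc _) = 0#

  0⊛ : ∀ f n → ((λ _ → 0#) ⊛ f) n ≈ 0#
  0⊛ f zero    = zeroˡ _
  0⊛ f (suc n) = trans (+-cong (zeroˡ _) (0⊛ f n)) (+-identityˡ _)

  const-⊛ : ∀ a f n → (const a ⊛ f) n ≈ a * f n
  const-⊛ a f zero    = refl
  const-⊛ a f (suc n) = trans (+-congˡ (0⊛ f n)) (+-identityʳ _)

  ring : CommutativeRing c ℓ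
  ring = record
    { Carrier = Series
    ; _≈_ = _≋_
    ; _+_ = _⊕_
    ; _*_ = _⊛_
    ; -_  = λ f n → - f n
    ; 0#  = λ _ → 0#
    ; 1#  = const 1#
    ; isCommutativeRing = record
      { isRing = record
        { +-isAbelianGroup = record
          { isGroup = record
            { isMonoid = record
              { isSemigroup = record
                { isMagma = record
                  { isEquivalence = record
                    { refl  = coefficientwise λ _ → refl
                    ; sym   = λ p → coefficientwise λ n → sym (at p n)
                    ; trans = λ p q → coefficientwise λ n → trans (at p n) (at q n)
                    }
                  ; ∙-cong = λ p q → coefficientwise λ n → +-cong (at p n) (at q n)
                  }
                ; assoc = λ f g h → coefficientwise λ n → +-assoc _ _ _
                }
              ; identity = (λ f → coefficientwise λ n → +-identityˡ _)
                         , (λ f → coefficientwise λ n → +-identityʳ _)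
              }
            ; inverse = (λ f → coefficientwise λ n → -‿inverseˡ _)
                      , (λ f → coefficientwise λ n → -‿inverseʳ _)
            ; ⁻¹-cong = λ p → coefficientwise λ n → -‿cong (at p n)
            }
          ; comm = λ f g → coefficientwise λ n → +-comm _ _
          }
        ; *-cong = λ p q → coefficientwise (⊛-cong-at (at p) (at q))
        ; *-assoc = λ f g h → coefficientwise (⊛-assoc-at f g h)
        ; *-identity = (λ f → coefficientwise (1⊛ f))
                     , (λ f → coefficientwise λ n → trans (⊛-comm-at f (const 1#) n) (1⊛ f n))
        ; distrib = (λ f g h → coefficientwise λ n →
                        trans (⊛-comm-at f (g ⊕ h) n)
                       (trans (⊛-distribʳ-at f g h n)
                              (+-cong (⊛-comm-at g f n) (⊛-comm-at h f n))))
                  , (λ f g h → coefficientwise (⊛-distribʳ-at f g h))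
        }
      ; *-comm = λ f g → coefficientwise (⊛-comm-at f g)
      }
    }
    where
    1⊛ : ∀ f n → (const 1# ⊛ f) n ≈ f n
    1⊛ f n = trans (const-⊛ 1# f n) (*-identityˡ _)

  X : Series
  X zero    = 0#
  X (suc n) = const 1# n

  X⊛ : ∀ f n → (X ⊛ f) (suc n) ≈ f n
  X⊛ f n = trans (+-cong (zeroˡ _) (trans (const-⊛ 1# f n) (*-identityˡ _))) (+-identityˡ _)

  -- Multiplication by the variable only shifts coefficients, so it is injective even when the
  -- coefficient ring has zero divisors.
  X-cancel : ∀ {f g} → X ⊛ f ≋ X ⊛ g → f ≋ g
  X-cancel {f} {g} p = coefficientwise λ n → trans (sym (X⊛ f n)) (trans (at p (suc n)) (X⊛ g n))

id-hom : IsQHom ℚring id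
id-hom = Algebra.Morphism.Construct.Identity.isRingHomomorphism (CommutativeRing.rawRing ℚring) ≡.refl

module Sums {c ℓ} (R : CommutativeRing c ℓ) (ι : ℚ → CommutativeRing.Carrier R) where
  open CommutativeRing R hiding (zero)
  open PowerSeries R using (Series; _⊛_; tail)

  Σ-cong : ∀ {f g} n → (∀ {k} → k ℕ.< n → f k ≈ g k) → Σ< R ι n f ≈ Σ< R ι n g
  Σ-cong zero    p = refl
  Σ-cong (suc n) p = +-cong (Σ-cong n λ k<n → p (ℕP.m≤n⇒m≤1+n k<n)) (p ℕP.≤-refl)

  Σ-head : ∀ f n → Σ< R ι (suc n) f ≈ f 0 + Σ< R ι n (λ k → f (suc k))
  Σ-head f zero    = +-comm _ _
  Σ-head f (suc n) = trans (+-congʳ (Σ-head f n)) (+-assoc _ _ _)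

  Σ-*ˡ : ∀ a f n → a * Σ< R ι n f ≈ Σ< R ι n (λ k → a * f k)
  Σ-*ˡ a f zero    = zeroʳ a
  Σ-*ˡ a f (suc n) = trans (distribˡ _ _ _) (+-congʳ (Σ-*ˡ a f n))

  Σ-*ʳ : ∀ a f n → Σ< R ι n f * a ≈ Σ< R ι n (λ k → f k * a)
  Σ-*ʳ a f zero    = zeroˡ a
  Σ-*ʳ a f (suc n) = trans (distribʳ _ _ _) (+-congʳ (Σ-*ʳ a f n))

  ⊛-Σ : ∀ f g n → (f ⊛ g) n ≈ Σ< R ι (suc n) (λ k → f k * g (n ∸ k))
  ⊛-Σ f g zero    = sym (+-identityˡ _)
  ⊛-Σ f g (suc n) = trans (+-congˡ (⊛-Σ (tail f) g n)) (sym (Σ-head _ (suc n)))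

-- Bernoulli and Euler numbers as coefficients of inverse series over ℚ.

module Rational where
  open QAlgebra ℚring id id-hom using (solve; con; _:+_; _:*_; :-_; _:=_)

  fromℕᵘ : ℕ → ℚᵘ.ℚᵘ
  fromℕᵘ n = ℚᵘ.mkℚᵘ (+ n) 0

  toℚᵘ-ℕ→ℚ : ∀ n → ℚ.toℚᵘ (ℕ→ℚ n) ℚᵘ.≃ fromℕᵘ n
  toℚᵘ-ℕ→ℚ n = ℚP.toℚᵘ-fromℚᵘ (fromℕᵘ n)

  ℕ→ℚ-+ : ∀ m n → ℕ→ℚ (m ℕ.+ n) ≡ ℕ→ℚ m ℚ.+ ℕ→ℚ n
  ℕ→ℚ-+ m n = ℚP.toℚᵘ-injective (begin
    ℚ.toℚᵘ (ℕ→ℚ (m ℕ.+ n))                ≈⟨ toℚᵘ-ℕ→ℚ (m ℕ.+ n) ⟩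
    fromℕᵘ (m ℕ.+ n)                       ≈⟨ ℚᵘ.*≡* (≡.cong (ℤ._* ℤ.1ℤ) (≡.cong₂ ℤ._+_ (≡.sym (ℤP.*-identityʳ (+ m))) (≡.sym (ℤP.*-identityʳ (+ n))))) ⟩
    fromℕᵘ m ℚᵘ.+ fromℕᵘ n                 ≈⟨ ℚᵘP.+-cong (toℚᵘ-ℕ→ℚ m) (toℚᵘ-ℕ→ℚ n) ⟨
    ℚ.toℚᵘ (ℕ→ℚ m) ℚᵘ.+ ℚ.toℚᵘ (ℕ→ℚ n)    ≈⟨ ℚP.toℚᵘ-homo-+ (ℕ→ℚ m) (ℕ→ℚ n) ⟨
    ℚ.toℚᵘ (ℕ→ℚ m ℚ.+ ℕ→ℚ n)              ∎)
    where open import Relation.Binary.Reasoning.Setoid ℚᵘP.≃-setoid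

  ℕ→ℚ-* : ∀ m n → ℕ→ℚ (m ℕ.* n) ≡ ℕ→ℚ m ℚ.* ℕ→ℚ n
  ℕ→ℚ-* m n = ℚP.toℚᵘ-injective (begin
    ℚ.toℚᵘ (ℕ→ℚ (m ℕ.* n))                ≈⟨ toℚᵘ-ℕ→ℚ (m ℕ.* n) ⟩
    fromℕᵘ (m ℕ.* n)                       ≈⟨ ℚᵘ.*≡* (≡.cong (ℤ._* ℤ.1ℤ) (ℤP.pos-* m n)) ⟩
    fromℕᵘ m ℚᵘ.* fromℕᵘ n                 ≈⟨ ℚᵘP.*-cong (toℚᵘ-ℕ→ℚ m) (toℚᵘ-ℕ→ℚ n) ⟨
    ℚ.toℚᵘ (ℕ→ℚ m) ℚᵘ.* ℚ.toℚᵘ (ℕ→ℚ n)    ≈⟨ ℚP.toℚᵘ-homo-* (ℕ→ℚ m) (ℕ→ℚ n) ⟨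
    ℚ.toℚᵘ (ℕ→ℚ m ℚ.* ℕ→ℚ n)              ∎)
    where open import Relation.Binary.Reasoning.Setoid ℚᵘP.≃-setoid

  recip : ∀ n → (+ 1 ℚ./ suc n) ℚ.* ℕ→ℚ (suc n) ≡ 1ℚ
  recip n = ℚP.toℚᵘ-injective (begin
    ℚ.toℚᵘ ((+ 1 ℚ./ suc n) ℚ.* ℕ→ℚ (suc n))              ≈⟨ ℚP.toℚᵘ-homo-* (+ 1 ℚ./ suc n) (ℕ→ℚ (suc n)) ⟩
    ℚ.toℚᵘ (+ 1 ℚ./ suc n) ℚᵘ.* ℚ.toℚᵘ (ℕ→ℚ (suc n))     ≈⟨ ℚᵘP.*-cong (ℚP.toℚᵘ-fromℚᵘ (ℚᵘ.mkℚᵘ (+ 1) n)) (toℚᵘ-ℕ→ℚ (suc n)) ⟩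
    ℚᵘ.mkℚᵘ (+ 1) n ℚᵘ.* fromℕᵘ (suc n)                    ≈⟨ ℚᵘP.*-inverseˡ (fromℕᵘ (suc n)) ⟩
    ℚᵘ.1ℚᵘ                                                 ∎)
    where open import Relation.Binary.Reasoning.Setoid ℚᵘP.≃-setoid

  invFact-! : ∀ n → invFact n ℚ.* ℕ→ℚ (n !) ≡ 1ℚ
  invFact-! zero    = ≡.refl
  invFact-! (suc n) = begin
    invFact n ℚ.* r ℚ.* ℕ→ℚ (suc n ℕ.* n !)             ≡⟨ ≡.cong (invFact n ℚ.* r ℚ.*_) (ℕ→ℚ-* (suc n) (n !)) ⟩
    invFact n ℚ.* r ℚ.* (ℕ→ℚ (suc n) ℚ.* ℕ→ℚ (n !))     ≡⟨ solve 4 (λ i r s f → i :* r :* (s :* f) := (r :* s) :* (i :* f)) ≡.refl (invFact n) r (ℕ→ℚ (suc n)) (ℕ→ℚ (n !)) ⟩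
    (r ℚ.* ℕ→ℚ (suc n)) ℚ.* (invFact n ℚ.* ℕ→ℚ (n !))   ≡⟨ ≡.cong₂ ℚ._*_ (recip n) (invFact-! n) ⟩
    1ℚ                                                   ∎
    where
    open ≡.≡-Reasoning
    r = + 1 ℚ./ suc n

  nCk*k!*[n∸k]!≡n! : ∀ {n k} → k ≤ n → (n C k) ℕ.* (k ! ℕ.* (n ∸ k) !) ≡ n !
  nCk*k!*[n∸k]!≡n! {n} {k} k≤n =
    ≡.trans (≡.cong (ℕ._* (k ! ℕ.* (n ∸ k) !)) (nCk≡n!/k![n-k]! k≤n)) (m/n*n≡m (k![n∸k]!∣n! k≤n))
    where instance _ = k ℕP.!* (n ∸ k) !≢0

  C-invFact : ∀ {n k} → k ≤ n → ℕ→ℚ (n C k) ℚ.* invFact n ≡ invFact k ℚ.* invFact (n ∸ k)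
  C-invFact {n} {k} k≤n = begin
    c ℚ.* i
      ≡⟨ solve 2 (λ c i → c :* i := c :* i :* (con 1ℚ :* con 1ℚ)) ≡.refl c i ⟩
    c ℚ.* i ℚ.* (1ℚ ℚ.* 1ℚ)
      ≡⟨ ≡.cong₂ (λ a b → c ℚ.* i ℚ.* (a ℚ.* b)) (invFact-! k) (invFact-! (n ∸ k)) ⟨
    c ℚ.* i ℚ.* ((ik ℚ.* fk) ℚ.* (ij ℚ.* fj))
      ≡⟨ solve 6 (λ c i ik fk ij fj → c :* i :* ((ik :* fk) :* (ij :* fj)) := (i :* (c :* (fk :* fj))) :* (ik :* ij)) ≡.refl c i ik fk ij fj ⟩
    (i ℚ.* (c ℚ.* (fk ℚ.* fj))) ℚ.* (ik ℚ.* ij)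
      ≡⟨ ≡.cong (λ a → (i ℚ.* (c ℚ.* a)) ℚ.* (ik ℚ.* ij)) (ℕ→ℚ-* (k !) ((n ∸ k) !)) ⟨
    (i ℚ.* (c ℚ.* ℕ→ℚ (k ! ℕ.* (n ∸ k) !))) ℚ.* (ik ℚ.* ij)
      ≡⟨ ≡.cong (λ a → (i ℚ.* a) ℚ.* (ik ℚ.* ij)) (ℕ→ℚ-* (n C k) (k ! ℕ.* (n ∸ k) !)) ⟨
    (i ℚ.* ℕ→ℚ ((n C k) ℕ.* (k ! ℕ.* (n ∸ k) !))) ℚ.* (ik ℚ.* ij)
      ≡⟨ ≡.cong (λ a → (i ℚ.* ℕ→ℚ a) ℚ.* (ik ℚ.* ij)) (nCk*k!*[n∸k]!≡n! k≤n) ⟩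
    (i ℚ.* ℕ→ℚ (n !)) ℚ.* (ik ℚ.* ij)
      ≡⟨ ≡.cong (ℚ._* (ik ℚ.* ij)) (invFact-! n) ⟩
    1ℚ ℚ.* (ik ℚ.* ij)
      ≡⟨ ℚP.*-identityˡ (ik ℚ.* ij) ⟩
    ik ℚ.* ij ∎
    where
    open ≡.≡-Reasoning
    c = ℕ→ℚ (n C k)
    i = invFact n
    ik = invFact k
    ij = invFact (n ∸ k)
    fk = ℕ→ℚ (k !)
    fj = ℕ→ℚ ((n ∸ k) !)

  -- Turns a term in a product of exponential generating functions into a term of a binomial
  -- convolution.
  invFact-C : ∀ b {n k} → k ≤ n → (b ℚ.* invFact k) ℚ.* invFact (n ∸ k) ≡ (ℕ→ℚ (n C k) ℚ.* b) ℚ.* invFact n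
  invFact-C b {n} {k} k≤n = begin
    (b ℚ.* invFact k) ℚ.* invFact (n ∸ k)   ≡⟨ ℚP.*-assoc b (invFact k) (invFact (n ∸ k)) ⟩
    b ℚ.* (invFact k ℚ.* invFact (n ∸ k))   ≡⟨ ≡.cong (b ℚ.*_) (C-invFact k≤n) ⟨
    b ℚ.* (ℕ→ℚ (n C k) ℚ.* invFact n)       ≡⟨ solve 3 (λ b c i → b :* (c :* i) := (c :* b) :* i) ≡.refl b (ℕ→ℚ (n C k)) (invFact n) ⟩
    (ℕ→ℚ (n C k) ℚ.* b) ℚ.* invFact n       ∎
    where
    open ≡.≡-Reasoning

  open PowerSeries ℚring using (_≋_; _⊛_; coefficientwise) renaming (const to constℚ)
  open Sums ℚring id

  Σℚ-Σ< : ∀ f n → Σℚ n f ≡ Σ< ℚring id n f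
  Σℚ-Σ< f zero    = ≡.refl
  Σℚ-Σ< f (suc n) = ≡.cong (ℚ._+ f n) (Σℚ-Σ< f n)

  Σℚ-cong : ∀ {f g} n → (∀ {k} → k ℕ.< n → f k ≡ g k) → Σℚ n f ≡ Σℚ n g
  Σℚ-cong {f} {g} n p = ≡.trans (Σℚ-Σ< f n) (≡.trans (Σ-cong n p) (≡.sym (Σℚ-Σ< g n)))

  ≡ᵇ-refl : ∀ n → (n ≡ᵇ n) ≡ true
  ≡ᵇ-refl zero    = ≡.refl
  ≡ᵇ-refl (suc n) = ≡ᵇ-refl n

  <⇒≡ᵇ-false : ∀ m n → m ℕ.< n → (m ≡ᵇ n) ≡ false
  <⇒≡ᵇ-false zero    (suc n) _         = ≡.refl
  <⇒≡ᵇ-false (suc m) (suc n) (s≤s m<n) = <⇒≡ᵇ-false m n m<n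

  module Table (table : ℕ → ℕ → ℚ) (next : (ℕ → ℚ) → ℕ → ℚ)
    (unfold : ∀ m k → table (suc m) k ≡ (if k ≡ᵇ suc m then next (table m) (suc m) else table m k)) where

    -- Passing from one table to the next alters only the newest entry. This replaces the entries of
    -- one fixed table, which the definition uses, by the numbers themselves, which the recurrence
    -- needs.
    table-stable : ∀ {k m} → k ≤ m → table m k ≡ table k k
    table-stable {k} {zero} z≤n = ≡.refl
    table-stable {k} {suc m} k≤1+m with k ℕP.≟ suc m
    ... | yes ≡.refl = ≡.refl
    ... | no  k≢1+m  = ≡.trans (unfold m k)
        (≡.trans (≡.cong (if_then next (table m) (suc m) else table m k) (<⇒≡ᵇ-false k (suc m) k<1+m))
                 (table-stable (ℕP.≤-pred k<1+m)))
      where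
      k<1+m = ℕP.≤∧≢⇒< k≤1+m k≢1+m

    diagonal : ∀ m → table (suc m) (suc m) ≡ next (table m) (suc m)
    diagonal m = ≡.trans (unfold m (suc m))
      (≡.cong (if_then next (table m) (suc m) else table m (suc m)) (≡ᵇ-refl m))

  module BTable = Table tableB nextB (λ _ _ → ≡.refl)
  module ETable = Table tableE nextE (λ _ _ → ≡.refl)

  [1+n]Cn≡1+n : ∀ n → suc n C n ≡ suc n
  [1+n]Cn≡1+n n = ≡.trans (nCk≡nC[n∸k] (ℕP.n≤1+n n)) (≡.trans (≡.cong (suc n C_) (ℕP.m+n∸n≡m 1 n)) (nC1≡n (suc n)))

  Bnum-recurrence : ∀ m → Σℚ (suc (suc m)) (λ k → ℕ→ℚ (suc (suc m) C k) ℚ.* Bnum k) ≡ 0ℚ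
  Bnum-recurrence m = begin
    S ℚ.+ ℕ→ℚ (suc (suc m) C suc m) ℚ.* Bnum (suc m)
      ≡⟨ ≡.cong₂ (λ a b → S ℚ.+ ℕ→ℚ a ℚ.* b) ([1+n]Cn≡1+n (suc m)) (BTable.diagonal m) ⟩
    S ℚ.+ N ℚ.* (ℚ.- (r ℚ.* Σℚ (suc m) (λ k → ℕ→ℚ (suc (suc m) C k) ℚ.* tableB m k)))
      ≡⟨ ≡.cong (λ a → S ℚ.+ N ℚ.* (ℚ.- (r ℚ.* a)))
           (Σℚ-cong (suc m) λ {k} k<1+m → ≡.cong (ℕ→ℚ (suc (suc m) C k) ℚ.*_) (BTable.table-stable (ℕP.≤-pred k<1+m))) ⟩
    S ℚ.+ N ℚ.* (ℚ.- (r ℚ.* S))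
      ≡⟨ solve 3 (λ s n r → s :+ n :* (:- (r :* s)) := s :+ :- ((r :* n) :* s)) ≡.refl S N r ⟩
    S ℚ.+ (ℚ.- ((r ℚ.* N) ℚ.* S))
      ≡⟨ ≡.cong (λ a → S ℚ.+ (ℚ.- (a ℚ.* S))) (recip (suc m)) ⟩
    S ℚ.+ (ℚ.- (1ℚ ℚ.* S))
      ≡⟨ solve 1 (λ s → s :+ :- (con 1ℚ :* s) := con 0ℚ) ≡.refl S ⟩
    0ℚ ∎
    where
    open ≡.≡-Reasoning
    S = Σℚ (suc m) (λ k → ℕ→ℚ (suc (suc m) C k) ℚ.* Bnum k)
    N = ℕ→ℚ (suc (suc m))
    r = + 1 ℚ./ suc (suc m)

  Enum-recurrence : ∀ m → Σℚ (suc (suc m)) (λ k → if even? (suc m ∸ k) then ℕ→ℚ (suc m C k) ℚ.* Enum k else 0ℚ) ≡ 0ℚ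
  Enum-recurrence m = begin
    S ℚ.+ (if even? (suc m ∸ suc m) then ℕ→ℚ (suc m C suc m) ℚ.* Enum (suc m) else 0ℚ)
      ≡⟨ ≡.cong (λ a → S ℚ.+ (if even? a then ℕ→ℚ (suc m C suc m) ℚ.* Enum (suc m) else 0ℚ)) (ℕP.n∸n≡0 m) ⟩
    S ℚ.+ ℕ→ℚ (suc m C suc m) ℚ.* Enum (suc m)
      ≡⟨ ≡.cong₂ (λ a b → S ℚ.+ ℕ→ℚ a ℚ.* b) (nCn≡1 (suc m)) (ETable.diagonal m) ⟩
    S ℚ.+ 1ℚ ℚ.* (ℚ.- Σℚ (suc m) (λ k → if even? (suc m ∸ k) then ℕ→ℚ (suc m C k) ℚ.* tableE m k else 0ℚ))
      ≡⟨ ≡.cong (λ a → S ℚ.+ 1ℚ ℚ.* (ℚ.- a))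
           (Σℚ-cong (suc m) λ {k} k<1+m → ≡.cong (λ a → if even? (suc m ∸ k) then ℕ→ℚ (suc m C k) ℚ.* a else 0ℚ)
                                                  (ETable.table-stable (ℕP.≤-pred k<1+m))) ⟩
    S ℚ.+ 1ℚ ℚ.* (ℚ.- S)
      ≡⟨ solve 1 (λ s → s :+ con 1ℚ :* :- s := con 0ℚ) ≡.refl S ⟩
    0ℚ ∎
    where
    open ≡.≡-Reasoning
    S = Σℚ (suc m) (λ k → if even? (suc m ∸ k) then ℕ→ℚ (suc m C k) ℚ.* Enum k else 0ℚ)

  -- Coefficients of w / (exp w - 1), (exp w - 1) / w, 1 / cosh w and cosh w.
  bern expm1/X eul cosh : ℕ → ℚ
  bern n = Bnum n ℚ.* invFact n
  expm1/X n = invFact (suc n)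
  eul n = Enum n ℚ.* invFact n
  cosh n = if even? n then invFact n else 0ℚ

  -- The coefficient of w^(m+1) is the Bernoulli recurrence divided by (m+2)!. Dividing exp w - 1 by
  -- w shifts the factorials by one, which is why the binomials come from row m+2.
  bern-inverse : bern ⊛ expm1/X ≋ constℚ 1ℚ
  bern-inverse = coefficientwise coeff
    where
    open ≡.≡-Reasoning
    coeff : ∀ n → (bern ⊛ expm1/X) n ≡ constℚ 1ℚ n
    coeff zero    = ≡.refl
    coeff (suc m) = begin
      (bern ⊛ expm1/X) (suc m)
        ≡⟨ ⊛-Σ bern expm1/X (suc m) ⟩
      Σ< ℚring id (suc (suc m)) (λ k → bern k ℚ.* invFact (suc (suc m ∸ k)))
        ≡⟨ Σ-cong (suc (suc m)) (λ k<m+2 → term (ℕP.≤-pred k<m+2)) ⟩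
      Σ< ℚring id (suc (suc m)) (λ k → (ℕ→ℚ (suc (suc m) C k) ℚ.* Bnum k) ℚ.* invFact (suc (suc m)))
        ≡⟨ Σ-*ʳ (invFact (suc (suc m))) _ (suc (suc m)) ⟨
      Σ< ℚring id (suc (suc m)) (λ k → ℕ→ℚ (suc (suc m) C k) ℚ.* Bnum k) ℚ.* invFact (suc (suc m))
        ≡⟨ ≡.cong (ℚ._* invFact (suc (suc m))) (≡.trans (≡.sym (Σℚ-Σ< _ (suc (suc m)))) (Bnum-recurrence m)) ⟩
      0ℚ ℚ.* invFact (suc (suc m))
        ≡⟨ ℚP.*-zeroˡ (invFact (suc (suc m))) ⟩
      0ℚ ∎
      where
      term : ∀ {k} → k ≤ suc m → bern k ℚ.* invFact (suc (suc m ∸ k)) ≡ (ℕ→ℚ (suc (suc m) C k) ℚ.* Bnum k) ℚ.* invFact (suc (suc m))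
      term {k} k≤1+m = ≡.trans (≡.cong (λ i → bern k ℚ.* invFact i) (≡.sym (ℕP.+-∸-assoc 1 k≤1+m)))
                               (invFact-C (Bnum k) (ℕP.m≤n⇒m≤1+n k≤1+m))

  -- The parity condition in the Euler recurrence is the vanishing of the odd coefficients of cosh.
  eul-inverse : eul ⊛ cosh ≋ constℚ 1ℚ
  eul-inverse = coefficientwise coeff
    where
    open ≡.≡-Reasoning
    coeff : ∀ n → (eul ⊛ cosh) n ≡ constℚ 1ℚ n
    coeff zero    = ≡.refl
    coeff (suc m) = begin
      (eul ⊛ cosh) (suc m)
        ≡⟨ ⊛-Σ eul cosh (suc m) ⟩
      Σ< ℚring id (suc (suc m)) (λ k → eul k ℚ.* cosh (suc m ∸ k))
        ≡⟨ Σ-cong (suc (suc m)) (λ k<m+2 → term (ℕP.≤-pred k<m+2)) ⟩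
      Σ< ℚring id (suc (suc m)) (λ k → (if even? (suc m ∸ k) then ℕ→ℚ (suc m C k) ℚ.* Enum k else 0ℚ) ℚ.* invFact (suc m))
        ≡⟨ Σ-*ʳ (invFact (suc m)) _ (suc (suc m)) ⟨
      Σ< ℚring id (suc (suc m)) (λ k → if even? (suc m ∸ k) then ℕ→ℚ (suc m C k) ℚ.* Enum k else 0ℚ) ℚ.* invFact (suc m)
        ≡⟨ ≡.cong (ℚ._* invFact (suc m)) (≡.trans (≡.sym (Σℚ-Σ< _ (suc (suc m)))) (Enum-recurrence m)) ⟩
      0ℚ ℚ.* invFact (suc m)
        ≡⟨ ℚP.*-zeroˡ (invFact (suc m)) ⟩
      0ℚ ∎
      where
      term : ∀ {k} → k ≤ suc m → eul k ℚ.* cosh (suc m ∸ k) ≡ (if even? (suc m ∸ k) then ℕ→ℚ (suc m C k) ℚ.* Enum k else 0ℚ) ℚ.* invFact (suc m)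
      term {k} k≤1+m with even? (suc m ∸ k)
      ... | false = ≡.trans (ℚP.*-zeroʳ (eul k)) (≡.sym (ℚP.*-zeroˡ (invFact (suc m))))
      ... | true  = invFact-C (Enum k) k≤1+m

open Rational

-- Constant series, powers, and the substitution of a w for w.

IsHom : ∀ {c ℓ c′ ℓ′} (R : CommutativeRing c ℓ) (S : CommutativeRing c′ ℓ′) →
        (CommutativeRing.Carrier R → CommutativeRing.Carrier S) → Set _
IsHom R S = RingMorphisms.IsRingHomomorphism (CommutativeRing.rawRing R) (CommutativeRing.rawRing S)

const-hom : ∀ {c ℓ} (R : CommutativeRing c ℓ) → IsHom R (PowerSeries.ring R) (PowerSeries.const R)
const-hom R = record
  { isSemiringHomomorphism = record
    { isNearSemiringHomomorphism = record
      { +-isMonoidHomomorphism = record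
        { isMagmaHomomorphism = record
          { isRelHomomorphism = record { cong = λ p → coefficientwise λ { zero → p ; (suc n) → refl } }
          ; homo = λ a b → coefficientwise λ { zero → refl ; (suc n) → sym (+-identityˡ 0#) }
          }
        ; ε-homo = coefficientwise λ { zero → refl ; (suc n) → refl }
        }
      ; *-homo = λ a b → coefficientwise λ
          { zero → refl ; (suc n) → sym (trans (const-⊛ a (const b) (suc n)) (zeroʳ a)) }
      }
    ; 1#-homo = coefficientwise λ _ → refl
    }
  ; -‿homo = λ a → coefficientwise λ { zero → refl ; (suc n) → sym -0#≈0# }
  }
  where
  open CommutativeRing R hiding (zero; ring)
  open PowerSeries R
  open import Algebra.Properties.Ring (CommutativeRing.ring R) using (-0#≈0#)

const∘-hom : ∀ {c ℓ} (R : CommutativeRing c ℓ) (ι : ℚ → CommutativeRing.Carrier R) → IsQHom R ι →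
             IsQHom (PowerSeries.ring R) (PowerSeries.const R ∘ ι)
const∘-hom R ι ι-hom = Algebra.Morphism.Construct.Composition.isRingHomomorphism
  (CommutativeRing.trans (PowerSeries.ring R)) ι-hom (const-hom R)

module Powers {c ℓ} (R : CommutativeRing c ℓ) (ι : ℚ → CommutativeRing.Carrier R) where
  open CommutativeRing R hiding (zero; ring)
  open import Algebra.Properties.CommutativeSemigroup *-commutativeSemigroup using (interchange)
  open import Algebra.Properties.Ring (CommutativeRing.ring R) using (-‿distribˡ-*; -‿distribʳ-*)

  pow-cong : ∀ {a b} n → a ≈ b → pow R ι a n ≈ pow R ι b n
  pow-cong zero    p = refl
  pow-cong (suc n) p = *-cong (pow-cong n p) p

  pow-* : ∀ a b n → pow R ι (a * b) n ≈ pow R ι a n * pow R ι b n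
  pow-* a b zero    = sym (*-identityˡ 1#)
  pow-* a b (suc n) = trans (*-congʳ (pow-* a b n)) (interchange _ _ _ _)

  pow-1 : ∀ n → pow R ι 1# n ≈ 1#
  pow-1 zero    = refl
  pow-1 (suc n) = trans (*-identityʳ _) (pow-1 n)

  pow-neg : ∀ a n → pow R ι (- a) n ≈ sgn R ι n * pow R ι a n
  pow-neg a zero    = sym (*-identityˡ 1#)
  pow-neg a (suc n) = begin
    pow R ι (- a) n * - a              ≈⟨ *-congʳ (pow-neg a n) ⟩
    sgn R ι n * pow R ι a n * - a      ≈⟨ -‿distribʳ-* _ _ ⟨
    - (sgn R ι n * pow R ι a n * a)    ≈⟨ -‿cong (*-assoc _ _ _) ⟩
    - (sgn R ι n * (pow R ι a n * a))  ≈⟨ -‿distribˡ-* _ _ ⟩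
    - sgn R ι n * (pow R ι a n * a)    ∎
    where open import Relation.Binary.Reasoning.Setoid setoid

module Scaling {c ℓ c′ ℓ′} (R : CommutativeRing c ℓ) (S : CommutativeRing c′ ℓ′) (ι : ℚ → CommutativeRing.Carrier S)
  {φ : CommutativeRing.Carrier R → CommutativeRing.Carrier S} (φ-hom : IsHom R S φ) where
  open CommutativeRing S hiding (zero; ring)
  private
    module R = CommutativeRing R
    module PR = PowerSeries R
  open PowerSeries S
  open Powers S ι
  open RingMorphisms.IsRingHomomorphism φ-hom
    using () renaming (+-homo to φ-+; *-homo to φ-*; 0#-homo to φ-0; ⟦⟧-cong to φ-cong)
  open import Algebra.Properties.CommutativeSemigroup *-commutativeSemigroup using (interchange)
  open import Relation.Binary.Reasoning.Setoid setoid

  -- The series f(a w), where w is the variable of the target.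
  scale : Carrier → PR.Series → Series
  scale a f n = φ (f n) * pow S ι a n

  scale-cong : ∀ {a b f g} → a ≈ b → f PR.≋ g → scale a f ≋ scale b g
  scale-cong p q = coefficientwise λ n → *-cong (φ-cong (PR.at q n)) (pow-cong n p)

  scale-const : ∀ a r → scale a (PR.const r) ≋ const (φ r)
  scale-const a r = coefficientwise λ
    { zero → *-identityʳ _ ; (suc n) → trans (*-congʳ φ-0) (zeroˡ _) }

  scale-⊛-at : ∀ a f g n → scale a (f PR.⊛ g) n ≈ (scale a f ⊛ scale a g) n
  scale-⊛-at a f g zero = begin
    φ (f 0 R.* g 0) * 1#             ≈⟨ *-cong (φ-* _ _) (sym (*-identityˡ 1#)) ⟩
    φ (f 0) * φ (g 0) * (1# * 1#)    ≈⟨ interchange _ _ _ _ ⟩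
    φ (f 0) * 1# * (φ (g 0) * 1#)    ∎
  scale-⊛-at a f g (suc n) = begin
    φ (f 0 R.* g (suc n) R.+ h) * (pow S ι a n * a)
      ≈⟨ *-congʳ (trans (φ-+ _ _) (+-congʳ (φ-* _ _))) ⟩
    (φ (f 0) * φ (g (suc n)) + φ h) * (pow S ι a n * a)
      ≈⟨ distribʳ _ _ _ ⟩
    φ (f 0) * φ (g (suc n)) * (pow S ι a n * a) + φ h * (pow S ι a n * a)
      ≈⟨ +-cong (trans (*-congʳ (*-congʳ (sym (*-identityʳ _)))) (*-assoc _ _ _)) (x∙yz≈a[xy] _ _ _) ⟩
    scale a f 0 * scale a g (suc n) + a * scale a (PR.tail f PR.⊛ g) n
      ≈⟨ +-congˡ (*-congˡ (scale-⊛-at a (PR.tail f) g n)) ⟩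
    scale a f 0 * scale a g (suc n) + a * (scale a (PR.tail f) ⊛ scale a g) n
      ≈⟨ +-congˡ (·-⊛-at a _ _ n) ⟨
    scale a f 0 * scale a g (suc n) + ((a · scale a (PR.tail f)) ⊛ scale a g) n
      ≈⟨ +-congˡ (⊛-cong-at (λ k → sym (x∙yz≈a[xy] _ _ _)) (λ k → refl) n) ⟩
    (scale a f ⊛ scale a g) (suc n) ∎
    where
    h = (PR.tail f PR.⊛ g) n
    x∙yz≈a[xy] : ∀ x y a → x * (y * a) ≈ a * (x * y)
    x∙yz≈a[xy] x y a = trans (sym (*-assoc x y a)) (*-comm _ _)

  scale-⊛ : ∀ a f g → scale a (f PR.⊛ g) ≋ scale a f ⊛ scale a g
  scale-⊛ a f g = coefficientwise (scale-⊛-at a f g)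

module ScaleComposition {c ℓ c′ ℓ′} (R : CommutativeRing c ℓ) (S : CommutativeRing c′ ℓ′)
  (ι : ℚ → CommutativeRing.Carrier R) (ι-hom : IsQHom R ι)
  {φ : CommutativeRing.Carrier R → CommutativeRing.Carrier S} (φ-hom : IsHom R S φ)
  (φι-hom : IsQHom S (φ ∘ ι)) where
  open CommutativeRing S hiding (zero; ring)
  open PowerSeries S using (_≋_; coefficientwise)
  open Powers S (φ ∘ ι)
  open RingMorphisms.IsRingHomomorphism φ-hom
    using () renaming (*-homo to φ-*; 1#-homo to φ-1)
  open Scaling ℚring R ι ι-hom using () renaming (scale to scaleι)
  open Scaling R S (φ ∘ ι) φ-hom using () renaming (scale to scaleφ)
  open Scaling ℚring S (φ ∘ ι) φι-hom using () renaming (scale to scaleφι)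

  pow-hom : ∀ a n → φ (pow R ι a n) ≈ pow S (φ ∘ ι) (φ a) n
  pow-hom a zero    = φ-1
  pow-hom a (suc n) = trans (φ-* _ _) (*-congʳ (pow-hom a n))

  -- Serves twice: to carry an identity proved over ℚ to an arbitrary scalar, and to carry series
  -- with coefficients in the base ring into the ring that contains u and γ.
  scale-scale : ∀ a b f → scaleφ a (scaleι b f) ≋ scaleφι (φ b * a) f
  scale-scale a b f = coefficientwise λ n →
    trans (*-congʳ (trans (φ-* _ _) (*-congˡ (pow-hom b n))))
   (trans (*-assoc _ _ _) (*-congˡ (sym (pow-* (φ b) a n))))

-- The exponential series and the series inverse to those of Bernoulli and Euler.

module Exponential {c ℓ} (S : CommutativeRing c ℓ) (ι : ℚ → CommutativeRing.Carrier S) (ι-hom : IsQHom S ι) where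
  open QAlgebra S ι ι-hom hiding (ring)
  open PowerSeries S
  open Powers S ι public
  open Scaling ℚring S ι ι-hom public
  open Reason

  module T = QAlgebra ring (const ∘ ι) (const∘-hom S ι ι-hom)

  N : ℕ → Carrier
  N n = ι (ℕ→ℚ n)

  N-suc : ∀ n → N (suc n) ≈ 1# + N n
  N-suc n = trans (ι-≡ (ℕ→ℚ-+ 1 n)) (trans (ι-+ _ _) (+-congʳ ι-1))

  -- The Euler operator w d/dw.
  θ : Series → Series
  θ f n = N n * f n

  -- The Leibniz rule for w d/dw. The induction matches n + 1 = 1 + n on the left with θ(w h) = w (h
  -- + θ h) on the right, which is `tail-θ`.
  θ-⊛ : ∀ f g n → N n * (f ⊛ g) n ≈ (θ f ⊛ g) n + (f ⊛ θ g) n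
  θ-⊛ f g zero    =
    solve 2 (λ x y → con 0ℚ :* (x :* y) := (con 0ℚ :* x) :* y :+ x :* (con 0ℚ :* y)) refl (f 0) (g 0)
  θ-⊛ f g (suc n) = begin
    N (suc n) * (f 0 * g (suc n) + h)
      ≈⟨ distribˡ _ _ _ ⟩
    N (suc n) * (f 0 * g (suc n)) + N (suc n) * h
      ≈⟨ +-congˡ (*-congʳ (N-suc n)) ⟩
    N (suc n) * (f 0 * g (suc n)) + (1# + N n) * h
      ≈⟨ solve 5 (λ a f g m h → a :* (f :* g) :+ (:1 :+ m) :* h := f :* (a :* g) :+ (h :+ m :* h)) refl
           (N (suc n)) (f 0) (g (suc n)) (N n) h ⟩
    f 0 * (N (suc n) * g (suc n)) + (h + N n * h)
      ≈⟨ +-congˡ (+-congˡ (θ-⊛ (tail f) g n)) ⟩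
    f 0 * (N (suc n) * g (suc n)) + (h + ((θ (tail f) ⊛ g) n + (tail f ⊛ θ g) n))
      ≈⟨ solve 4 (λ a h p q → a :+ (h :+ (p :+ q)) := (con 0ℚ :+ (h :+ p)) :+ (a :+ q)) refl
           (f 0 * (N (suc n) * g (suc n))) h ((θ (tail f) ⊛ g) n) ((tail f ⊛ θ g) n) ⟩
    (ι 0ℚ + (h + (θ (tail f) ⊛ g) n)) + (f 0 * (N (suc n) * g (suc n)) + (tail f ⊛ θ g) n)
      ≈⟨ +-congʳ (+-cong (solve 2 (λ x y → con 0ℚ := con 0ℚ :* x :* y) refl (f 0) (g (suc n)))
                         (sym (trans (⊛-cong-at tail-θ (λ _ → refl) n) (⊛-distribʳ-at g (tail f) (θ (tail f)) n)))) ⟩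
    (θ f ⊛ g) (suc n) + (f ⊛ θ g) (suc n) ∎
    where
    h = (tail f ⊛ g) n
    tail-θ : ∀ k → tail (θ f) k ≈ (tail f ⊕ θ (tail f)) k
    tail-θ k = trans (*-congʳ (N-suc k)) (trans (distribʳ _ _ _) (+-congʳ (*-identityˡ _)))

  e : Carrier → Series
  e a = scale a invFact

  N-invFact : ∀ n → ι (+ 1 ℚ./ suc n) * N (suc n) ≈ 1#
  N-invFact n = trans (sym (ι-* _ _)) (trans (ι-≡ (recip n)) ι-1)

  e-suc : ∀ a n → e a (suc n) ≈ ι (+ 1 ℚ./ suc n) * (a * e a n)
  e-suc a n = trans (*-congʳ (ι-* _ _))
    (solve 4 (λ i r p a → i :* r :* (p :* a) := r :* (a :* (i :* p))) refl (ι (invFact n)) (ι (+ 1 ℚ./ suc n)) (pow S ι a n) a)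

  tail-θ-e : ∀ a n → tail (θ (e a)) n ≈ a * e a n
  tail-θ-e a n = begin
    N (suc n) * e a (suc n)                           ≈⟨ *-congˡ (e-suc a n) ⟩
    N (suc n) * (ι (+ 1 ℚ./ suc n) * (a * e a n))     ≈⟨ solve 3 (λ m r x → m :* (r :* x) := (r :* m) :* x) refl _ _ _ ⟩
    (ι (+ 1 ℚ./ suc n) * N (suc n)) * (a * e a n)     ≈⟨ *-congʳ (N-invFact n) ⟩
    1# * (a * e a n)                                  ≈⟨ *-identityˡ _ ⟩
    a * e a n                                         ∎

  -- The differential equation θ e(a) = a w e(a), multiplied by g; the factor w lowers the index.
  θ-e-⊛ : ∀ a g n → (θ (e a) ⊛ g) (suc n) ≈ a * (e a ⊛ g) n
  θ-e-⊛ a g n = begin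
    N 0 * e a 0 * g (suc n) + (tail (θ (e a)) ⊛ g) n
      ≈⟨ +-cong (solve 2 (λ x y → con 0ℚ :* x :* y := con 0ℚ) refl (e a 0) (g (suc n))) (⊛-cong-at (tail-θ-e a) (λ _ → refl) n) ⟩
    ι 0ℚ + ((a · e a) ⊛ g) n
      ≈⟨ +-cong ι-0 (·-⊛-at a (e a) g n) ⟩
    0# + a * (e a ⊛ g) n
      ≈⟨ +-identityˡ _ ⟩
    a * (e a ⊛ g) n ∎

  -- Both sides satisfy θ f = (a + b) w f with the same constant term.
  e-+-at : ∀ a b n → (e a ⊛ e b) n ≈ e (a + b) n
  e-+-at a b zero    = solve 0 (con 1ℚ :* :1 :* (con 1ℚ :* :1) := con 1ℚ :* :1) refl
  e-+-at a b (suc n) = begin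
    p (suc n)
      ≈⟨ *-identityˡ _ ⟨
    1# * p (suc n)
      ≈⟨ *-congʳ (N-invFact n) ⟨
    r * N (suc n) * p (suc n)
      ≈⟨ *-assoc _ _ _ ⟩
    r * (N (suc n) * p (suc n))
      ≈⟨ *-congˡ (θ-⊛ (e a) (e b) (suc n)) ⟩
    r * ((θ (e a) ⊛ e b) (suc n) + (e a ⊛ θ (e b)) (suc n))
      ≈⟨ *-congˡ (+-cong (θ-e-⊛ a (e b) n) (trans (⊛-comm-at (e a) (θ (e b)) (suc n)) (θ-e-⊛ b (e a) n))) ⟩
    r * (a * p n + b * (e b ⊛ e a) n)
      ≈⟨ *-congˡ (+-congˡ (*-congˡ (⊛-comm-at (e b) (e a) n))) ⟩
    r * (a * p n + b * p n)
      ≈⟨ *-congˡ (distribʳ _ _ _) ⟨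
    r * ((a + b) * p n)
      ≈⟨ *-congˡ (*-congˡ (e-+-at a b n)) ⟩
    r * ((a + b) * e (a + b) n)
      ≈⟨ e-suc (a + b) n ⟨
    e (a + b) (suc n) ∎
    where
    p = e a ⊛ e b
    r = ι (+ 1 ℚ./ suc n)

  e-+ : ∀ a b → e a ⊛ e b ≋ e (a + b)
  e-+ a b = coefficientwise (e-+-at a b)

  e-cong : ∀ {a b} → a ≈ b → e a ≋ e b
  e-cong p = scale-cong p (CommutativeRing.refl (PowerSeries.ring ℚring))

  e-0 : e 0# ≋ const 1#
  e-0 = coefficientwise λ
    { zero → trans (*-congʳ ι-1) (*-identityˡ _)
    ; (suc n) → trans (*-congˡ (zeroʳ _)) (zeroʳ _) }

  -- The series (e(a) - 1) / (a w), given by its coefficients because a need not be invertible.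
  q : Carrier → Series
  q a = scale a expm1/X

  e-q : ∀ a → e a ≋ const 1# ⊕ X ⊛ (const a ⊛ q a)
  e-q a = coefficientwise λ
    { zero → trans (solve 1 (λ a → con 1ℚ :* :1 := :1 :+ con 0ℚ :* (a :* (con 1ℚ :* :1))) refl a)
                     (+-congˡ (*-congʳ ι-0))
    ; (suc n) → begin
        ι (invFact (suc n)) * (pow S ι a n * a)  ≈⟨ solve 3 (λ i p a → i :* (p :* a) := a :* (i :* p)) refl _ _ _ ⟩
        a * q a n                                ≈⟨ const-⊛ a (q a) n ⟨
        (const a ⊛ q a) n                        ≈⟨ X⊛ (const a ⊛ q a) n ⟨
        (X ⊛ (const a ⊛ q a)) (suc n)            ≈⟨ +-identityˡ _ ⟨
        0# + (X ⊛ (const a ⊛ q a)) (suc n)       ∎ }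

  β : Carrier → Series
  β a = scale a bern

  scale-1 : ∀ a → scale a (PowerSeries.const ℚring 1ℚ) ≋ const 1#
  scale-1 a = T.trans (scale-const a 1ℚ) (coefficientwise λ { zero → ι-1 ; (suc n) → refl })

  β-q : ∀ a → β a ⊛ q a ≋ const 1#
  β-q a = T.trans (T.sym (scale-⊛ a bern expm1/X)) (T.trans (scale-cong refl bern-inverse) (scale-1 a))

  η ch : Carrier → Series
  η a = scale (ι ½ * a) eul
  ch a = scale (ι ½ * a) cosh

  η-ch : ∀ a → η a ⊛ ch a ≋ const 1#
  η-ch a = T.trans (T.sym (scale-⊛ (ι ½ * a) eul cosh)) (T.trans (scale-cong refl eul-inverse) (scale-1 (ι ½ * a)))

  1+sgn : ∀ n (i : ℚ) → ι ½ * (ι i + sgn S ι n * ι i) ≈ ι (if even? n then i else 0ℚ)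
  1+sgn zero i = solve 1 (λ i → con ½ :* (i :+ :1 :* i) := i) refl (ι i)
  1+sgn (suc zero) i = solve 1 (λ i → con ½ :* (i :+ (:- :1) :* i) := con 0ℚ) refl (ι i)
  1+sgn (suc (suc n)) i = trans (solve 2 (λ s i → con ½ :* (i :+ :- :- s :* i) := con ½ :* (i :+ s :* i)) refl (sgn S ι n) (ι i)) (1+sgn n i)

  cosh-e : ∀ a → scale a cosh ≋ const (ι ½) ⊛ (e a ⊕ e (- a))
  cosh-e a = coefficientwise λ n → begin
    ι (cosh n) * pow S ι a n
      ≈⟨ *-congʳ (1+sgn n (invFact n)) ⟨
    ι ½ * (ι (invFact n) + sgn S ι n * ι (invFact n)) * pow S ι a n
      ≈⟨ solve 3 (λ i s p → con ½ :* (i :+ s :* i) :* p := con ½ :* (i :* p :+ i :* (s :* p))) refl _ _ _ ⟩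
    ι ½ * (e a n + ι (invFact n) * (sgn S ι n * pow S ι a n))
      ≈⟨ *-congˡ (+-congˡ (*-congˡ (pow-neg a n))) ⟨
    ι ½ * (e a n + e (- a) n)
      ≈⟨ const-⊛ (ι ½) _ n ⟨
    (const (ι ½) ⊛ (e a ⊕ e (- a))) n ∎

-- Reflection formulas and the two relations between products of series.

private
  module ℚE = Exponential ℚring id id-hom

-- Proved first at a = 1, because e(a) - 1 = a w q(a) determines q(a) only if a is not a zero divisor.
q-neg-ℚ : ℚE.q (ℚ.- 1ℚ) ℚE.T.* ℚE.e 1ℚ ℚE.T.≈ ℚE.q 1ℚ
q-neg-ℚ = X-cancel (begin
  X * (q (ℚ.- 1ℚ) * e 1ℚ)
    -- Since e(-1) = 1 - w q(-1), the left side is (1 - e(-1)) e(1), written so that `e-q` can be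
    -- applied backwards.
    ≈⟨ solve 3 (λ x p f → x :* (p :* f) := f :- (:1 :+ x :* (con (ℚ.- 1ℚ) :* p)) :* f) refl X (q (ℚ.- 1ℚ)) (e 1ℚ) ⟩
  e 1ℚ - (1# + X * (const (ℚ.- 1ℚ) * q (ℚ.- 1ℚ))) * e 1ℚ
    ≈⟨ +-congˡ {x = e 1ℚ} (-‿cong (*-congʳ (e-q (ℚ.- 1ℚ)))) ⟨
  e 1ℚ - e (ℚ.- 1ℚ) * e 1ℚ
    ≈⟨ +-congˡ {x = e 1ℚ} (-‿cong (trans (e-+ (ℚ.- 1ℚ) 1ℚ) e-0)) ⟩
  e 1ℚ - 1#
    ≈⟨ +-congʳ (e-q 1ℚ) ⟩
  1# + X * (const 1ℚ * q 1ℚ) - 1#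
    ≈⟨ solve 2 (λ x p → :1 :+ x :* (con 1ℚ :* p) :- :1 := x :* p) refl X (q 1ℚ) ⟩
  X * q 1ℚ ∎)
  where
  open ℚE using (q; e; e-q; e-+; e-0)
  open PowerSeries ℚring using (X; X-cancel; const)
  open ℚE.T
  open Reason

module Symmetry {c ℓ} (S : CommutativeRing c ℓ) (ι : ℚ → CommutativeRing.Carrier S) (ι-hom : IsQHom S ι) where
  open Exponential S ι ι-hom public
  private
    module S = QAlgebra S ι ι-hom
    module Tℚ = CommutativeRing (PowerSeries.ring ℚring)
  open PowerSeries S using (X; X-cancel; const; _≋_; coefficientwise)
  open CommutativeRing S using () renaming (Carrier to A; _≈_ to _≈ₛ_; _*_ to _*ₛ_; _+_ to _+ₛ_; _-_ to _-ₛ_; -_ to -ₛ_; 1# to 1ₛ)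
  open T hiding (ring)
  open Reason
  open ScaleComposition ℚring S id id-hom ι-hom ι-hom using (scale-scale)
  open import Algebra.Properties.CommutativeSemigroup *-commutativeSemigroup using (interchange)

  const-cong : ∀ {a b} → a ≈ₛ b → const a ≈ const b
  const-cong p = coefficientwise λ { zero → p ; (suc n) → S.refl }

  const-* : ∀ a b → const (a *ₛ b) ≈ const a * const b
  const-* = RingMorphisms.IsRingHomomorphism.*-homo (const-hom S)

  -- Replacing w by a w in the rational identity, with no cancellation of a.
  q-neg : ∀ a → q (-ₛ a) * e a ≈ q a
  q-neg a = begin
    q (-ₛ a) * e a
      ≈⟨ *-cong (scale-cong (S.solve 1 (λ a → S.:- a S.:= S.con (ℚ.- 1ℚ) S.:* a) S.refl a) Tℚ.refl)
                (scale-cong (S.solve 1 (λ a → a S.:= S.con 1ℚ S.:* a) S.refl a) Tℚ.refl) ⟩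
    q (ι (ℚ.- 1ℚ) *ₛ a) * e (ι 1ℚ *ₛ a)
      ≈⟨ *-cong (scale-scale a (ℚ.- 1ℚ) expm1/X) (scale-scale a 1ℚ invFact) ⟨
    scale a (ℚE.q (ℚ.- 1ℚ)) * scale a (ℚE.e 1ℚ)
      ≈⟨ scale-⊛ a (ℚE.q (ℚ.- 1ℚ)) (ℚE.e 1ℚ) ⟨
    scale a (ℚE.q (ℚ.- 1ℚ) Tℚ.* ℚE.e 1ℚ)
      ≈⟨ scale-cong S.refl q-neg-ℚ ⟩
    scale a (ℚE.q 1ℚ)
      ≈⟨ scale-scale a 1ℚ expm1/X ⟩
    q (ι 1ℚ *ₛ a)
      ≈⟨ scale-cong (S.solve 1 (λ a → S.con 1ℚ S.:* a S.:= a) S.refl a) Tℚ.refl ⟩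
    q a ∎

  inverse-unique : ∀ {f g h} → f * g ≈ 1# → h * g ≈ 1# → f ≈ h
  inverse-unique {f} {g} {h} fg hg = begin
    f            ≈⟨ *-identityʳ f ⟨
    f * 1#       ≈⟨ *-congˡ hg ⟨
    f * (h * g)  ≈⟨ solve 3 (λ f g h → f :* (h :* g) := h :* (f :* g)) refl f g h ⟩
    h * (f * g)  ≈⟨ *-congˡ fg ⟩
    h * 1#       ≈⟨ *-identityʳ h ⟩
    h            ∎

  -- Both sides are inverse to q(-a). This is the series form of the reflection B_n(1 - x) = (-1)^n
  -- B_n(x).
  β-neg : ∀ a → β (-ₛ a) ≈ e a * β a
  β-neg a = inverse-unique (β-q (-ₛ a)) (begin
    e a * β a * q (-ₛ a)    ≈⟨ solve 3 (λ e b q → e :* b :* q := b :* (q :* e)) refl (e a) (β a) (q (-ₛ a)) ⟩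
    β a * (q (-ₛ a) * e a)  ≈⟨ *-congˡ (q-neg a) ⟩
    β a * q a               ≈⟨ β-q a ⟩
    1#                      ∎)

  ch-e : ∀ a → ch a ≈ const (ι ½) * (e (ι ½ *ₛ a) + e (-ₛ (ι ½ *ₛ a)))
  ch-e a = cosh-e (ι ½ *ₛ a)

  ch-neg : ∀ a → ch (-ₛ a) ≈ ch a
  ch-neg a = begin
    ch (-ₛ a)
      ≈⟨ ch-e (-ₛ a) ⟩
    const (ι ½) * (e (ι ½ *ₛ -ₛ a) + e (-ₛ (ι ½ *ₛ -ₛ a)))
      ≈⟨ *-congˡ (+-comm _ _) ⟩
    const (ι ½) * (e (-ₛ (ι ½ *ₛ -ₛ a)) + e (ι ½ *ₛ -ₛ a))
      ≈⟨ *-congˡ (+-cong (e-cong (S.solve 1 (λ a → S.:- (S.con ½ S.:* S.:- a) S.:= S.con ½ S.:* a) S.refl a))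
                         (e-cong (S.solve 1 (λ a → S.con ½ S.:* S.:- a S.:= S.:- (S.con ½ S.:* a)) S.refl a))) ⟩
    const (ι ½) * (e (ι ½ *ₛ a) + e (-ₛ (ι ½ *ₛ a)))
      ≈⟨ ch-e a ⟨
    ch a ∎

  η-neg : ∀ a → η (-ₛ a) ≈ η a
  η-neg a = inverse-unique (trans (*-congˡ (sym (ch-neg a))) (η-ch (-ₛ a))) (η-ch a)

  -- The definition of β(a) as a w / (e(a) - 1), freed of its denominator. It lets a scalar factor a
  -- supply a missing β(a) once w has been multiplied in.
  Xβ : ∀ a → X * const a ≈ (e a - 1#) * β a
  Xβ a = begin
    X * const a                              ≈⟨ *-identityʳ _ ⟨
    X * const a * 1#                         ≈⟨ *-congˡ (β-q a) ⟨
    X * const a * (β a * q a)                ≈⟨ solve 4 (λ x c b q → x :* c :* (b :* q) := ((:1 :+ x :* (c :* q)) :- :1) :* b) refl X (const a) (β a) (q a) ⟩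
    (1# + X * (const a * q a) - 1#) * β a    ≈⟨ *-congʳ (+-congʳ (e-q a)) ⟨
    (e a - 1#) * β a                         ∎

  Bs Es : A → A → Carrier
  Bs x a = β a * e (x *ₛ a)
  Es x a = η a * e ((x -ₛ ι ½) *ₛ a)

  Bs-neg : ∀ x a → Bs x (-ₛ a) ≈ β a * e (a -ₛ x *ₛ a)
  Bs-neg x a = begin
    β (-ₛ a) * e (x *ₛ -ₛ a)        ≈⟨ *-congʳ (β-neg a) ⟩
    e a * β a * e (x *ₛ -ₛ a)       ≈⟨ solve 3 (λ e b f → e :* b :* f := b :* (e :* f)) refl (e a) (β a) (e (x *ₛ -ₛ a)) ⟩
    β a * (e a * e (x *ₛ -ₛ a))     ≈⟨ *-congˡ (e-+ a (x *ₛ -ₛ a)) ⟩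
    β a * e (a +ₛ x *ₛ -ₛ a)        ≈⟨ *-congˡ (e-cong (S.solve 2 (λ x a → a S.:+ x S.:* S.:- a S.:= a S.:- x S.:* a) S.refl x a)) ⟩
    β a * e (a -ₛ x *ₛ a)           ∎

  product : ∀ {b b′ a a′ d} → a +ₛ a′ ≈ₛ d → (b * e a) * (b′ * e a′) ≈ b * b′ * e d
  product p = trans (interchange _ _ _ _) (*-congˡ (trans (e-+ _ _) (e-cong p)))

  module _ (x y z u v g : A) (x+y+z≈1 : x +ₛ y +ₛ z ≈ₛ 1ₛ) (v≈u+g : v ≈ₛ u +ₛ g) where
    private
      z≈ : z ≈ₛ 1ₛ -ₛ x -ₛ y
      z≈ = S.trans (S.solve 3 (λ x y z → z S.:= (x S.:+ y S.:+ z) S.:- x S.:- y) S.refl x y z)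
                   (S.+-congʳ (S.+-congʳ x+y+z≈1))

      g≈ : g ≈ₛ v -ₛ u
      g≈ = S.trans (S.solve 2 (λ u g → g S.:= (u S.:+ g) S.:- u) S.refl u g) (S.+-congʳ (S.sym v≈u+g))

      -- The exponent of B(y, v) B(x, u). Eliminating z and g by the two hypotheses gives the other
      -- products in `three-Bernoulli` the exponents P and g + P.
      P = x *ₛ u +ₛ y *ₛ v

    -- Each product lacks exactly one of β(g), β(u), β(v). After multiplication by w the scalar in
    -- front supplies it by `Xβ`. Without the common factor β(g) β(u) β(v) e(P) what remains is
    -- (e(g) - 1) + (e(u) - 1) e(g) = e(v) - 1, which holds as v = u + g.
    three-Bernoulli : const g * (Bs y v * Bs x u) + const u * (Bs x (-ₛ g) * Bs z (-ₛ v)) ≈ const v * (Bs z (-ₛ u) * Bs y g)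
    three-Bernoulli = X-cancel (begin
      X * (const g * (Bs y v * Bs x u) + const u * (Bs x (-ₛ g) * Bs z (-ₛ v)))
        ≈⟨ *-congˡ (+-cong (*-congˡ F₁) (*-congˡ F₃)) ⟩
      X * (const g * (β v * β u * e P) + const u * (β g * β v * (e g * e P)))
        ≈⟨ solve 8 (λ x g u bg bu bv eg eP → x :* (g :* (bv :* bu :* eP) :+ u :* (bg :* bv :* (eg :* eP)))
                     := (x :* g) :* (bv :* bu :* eP) :+ (x :* u) :* (bg :* bv :* (eg :* eP))) refl
             X (const g) (const u) (β g) (β u) (β v) (e g) (e P) ⟩
      X * const g * (β v * β u * e P) + X * const u * (β g * β v * (e g * e P))
        ≈⟨ +-cong (*-congʳ (Xβ g)) (*-congʳ (Xβ u)) ⟩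
      (e g - 1#) * β g * (β v * β u * e P) + (e u - 1#) * β u * (β g * β v * (e g * e P))
        ≈⟨ solve 6 (λ bg bu bv eg eu eP → (eg :- :1) :* bg :* (bv :* bu :* eP) :+ (eu :- :1) :* bu :* (bg :* bv :* (eg :* eP))
                     := (eu :* eg :- :1) :* bv :* (bu :* bg :* eP)) refl (β g) (β u) (β v) (e g) (e u) (e P) ⟩
      (e u * e g - 1#) * β v * (β u * β g * e P)
        ≈⟨ *-congʳ (*-congʳ (+-congʳ (trans (e-+ u g) (e-cong (S.sym v≈u+g))))) ⟩
      (e v - 1#) * β v * (β u * β g * e P)
        ≈⟨ *-cong (Xβ v) F₂ ⟨
      X * const v * (Bs z (-ₛ u) * Bs y g)
        ≈⟨ *-assoc _ _ _ ⟩
      X * (const v * (Bs z (-ₛ u) * Bs y g)) ∎)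
      where
      F₁ : Bs y v * Bs x u ≈ β v * β u * e P
      F₁ = product (S.+-comm _ _)

      F₂ : Bs z (-ₛ u) * Bs y g ≈ β u * β g * e P
      F₂ = trans (*-congʳ (Bs-neg z u)) (product
        (S.trans (S.+-cong (S.+-congˡ (S.-‿cong (S.*-congʳ z≈))) (S.*-congˡ g≈))
          (S.solve 4 (λ x y u v → (u S.:- (S.:1 S.:- x S.:- y) S.:* u) S.:+ y S.:* (v S.:- u) S.:= x S.:* u S.:+ y S.:* v) S.refl x y u v)))

      F₃ : Bs x (-ₛ g) * Bs z (-ₛ v) ≈ β g * β v * (e g * e P)
      F₃ = trans (*-cong (Bs-neg x g) (Bs-neg z v)) (trans (product
        (S.trans (S.+-cong (S.+-congˡ (S.-‿cong (S.*-congˡ g≈))) (S.+-congˡ (S.-‿cong (S.*-congʳ z≈))))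
          (S.solve 5 (λ x y u v g → (g S.:- x S.:* (v S.:- u)) S.:+ (v S.:- (S.:1 S.:- x S.:- y) S.:* v) S.:= g S.:+ (x S.:* u S.:+ y S.:* v)) S.refl x y u v g)))
        (*-congˡ (sym (e-+ g P))))

    private
      P′ = (y -ₛ ι ½) *ₛ v +ₛ (x -ₛ ι ½) *ₛ u

      half : ∀ a d d₊ d₋ → ι ½ *ₛ a +ₛ d ≈ₛ d₊ → -ₛ (ι ½ *ₛ a) +ₛ d ≈ₛ d₋ → ch a * e d ≈ const (ι ½) * (e d₊ + e d₋)
      half a d d₊ d₋ p₊ p₋ = begin
        ch a * e d
          ≈⟨ *-congʳ (ch-e a) ⟩
        const (ι ½) * (e (ι ½ *ₛ a) + e (-ₛ (ι ½ *ₛ a))) * e d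
          ≈⟨ trans (*-assoc _ _ _) (*-congˡ (distribʳ _ _ _)) ⟩
        const (ι ½) * (e (ι ½ *ₛ a) * e d + e (-ₛ (ι ½ *ₛ a)) * e d)
          ≈⟨ *-congˡ (+-cong (trans (e-+ _ _) (e-cong p₊)) (trans (e-+ _ _) (e-cong p₋))) ⟩
        const (ι ½) * (e d₊ + e d₋) ∎

    -- The left product lacks η(u) and the first one on the right lacks η(v); they are inserted as
    -- η(u) ch(u) = 1 and η(v) ch(v) = 1. The hyperbolic cosines turn the exponentials into ½(e(P′ +
    -- v) + e(g + P′)) and ½(e(P′ + v) + e(P′)). Their difference is ½ (e(g) - 1) e(P′) = ½ g w q(g)
    -- e(P′), and β(g) q(g) = 1 removes the Bernoulli factor from the last term.
    Bernoulli-Euler : Bs x (-ₛ g) * Es z (-ₛ v) ≈ Bs y g * Es z (-ₛ u) + X * (const (ι ½ *ₛ g) * (Es y v * Es x u))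
    Bernoulli-Euler = begin
      Bs x (-ₛ g) * Es z (-ₛ v)
        ≈⟨ F₁ ⟩
      β g * η v * e d₁
        ≈⟨ trans (sym (*-identityʳ _)) (*-congˡ (sym (η-ch u))) ⟩
      β g * η v * e d₁ * (η u * ch u)
        ≈⟨ solve 5 (λ b hv d hu cu → b :* hv :* d :* (hu :* cu) := b :* hv :* hu :* (cu :* d)) refl (β g) (η v) (e d₁) (η u) (ch u) ⟩
      β g * η v * η u * (ch u * e d₁)
        ≈⟨ *-congˡ (half u d₁ (P′ +ₛ v) (g +ₛ P′)
             (S.solve 2 (λ p u → S.con ½ S.:* u S.:+ (p S.:- S.con ½ S.:* u) S.:= p) S.refl (P′ +ₛ v) u)
             (S.trans (S.solve 3 (λ p v u → S.:- (S.con ½ S.:* u) S.:+ (p S.:+ v S.:- S.con ½ S.:* u) S.:= (v S.:- u) S.:+ p) S.refl P′ v u) (S.+-congʳ (S.sym g≈)))) ⟩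
      β g * η v * η u * (const (ι ½) * (e (P′ +ₛ v) + e (g +ₛ P′)))
        ≈⟨ *-congˡ (*-congˡ (+-congˡ (trans (sym (e-+ g P′)) (*-congʳ (e-q g))))) ⟩
      β g * η v * η u * (const (ι ½) * (e (P′ +ₛ v) + (1# + X * (const g * q g)) * e P′))
        ≈⟨ solve 9 (λ b hv hu E d X g q h → b :* hv :* hu :* (h :* (E :+ (:1 :+ X :* (g :* q)) :* d)) :=
               b :* hu :* hv :* (h :* (E :+ d)) :+ (b :* q) :* (X :* ((h :* g) :* (hv :* hu :* d)))) refl
             (β g) (η v) (η u) (e (P′ +ₛ v)) (e P′) X (const g) (q g) (const (ι ½)) ⟩
      β g * η u * η v * (const (ι ½) * (e (P′ +ₛ v) + e P′)) + β g * q g * (X * (const (ι ½) * const g * (η v * η u * e P′)))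
        ≈⟨ +-cong (*-congˡ (sym (half v d₂ (P′ +ₛ v) P′
               (S.solve 2 (λ p v → S.con ½ S.:* v S.:+ (p S.:+ S.con ½ S.:* v) S.:= p S.:+ v) S.refl P′ v)
               (S.solve 2 (λ p v → S.:- (S.con ½ S.:* v) S.:+ (p S.:+ S.con ½ S.:* v) S.:= p) S.refl P′ v))))
             (trans (*-congʳ (β-q g)) (trans (*-identityˡ _) (*-congˡ (*-cong (sym (const-* (ι ½) g)) (sym F₃))))) ⟩
      β g * η u * η v * (ch v * e d₂) + X * (const (ι ½ *ₛ g) * (Es y v * Es x u))
        ≈⟨ +-congʳ (solve 5 (λ b hu hv cv d → b :* hu :* hv :* (cv :* d) := b :* hu :* d :* (hv :* cv)) refl (β g) (η u) (η v) (ch v) (e d₂)) ⟩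
      β g * η u * e d₂ * (η v * ch v) + X * (const (ι ½ *ₛ g) * (Es y v * Es x u))
        ≈⟨ +-congʳ (trans (*-congˡ (η-ch v)) (trans (*-identityʳ _) (sym F₂))) ⟩
      Bs y g * Es z (-ₛ u) + X * (const (ι ½ *ₛ g) * (Es y v * Es x u)) ∎
      where
      d₁ = P′ +ₛ v -ₛ ι ½ *ₛ u
      d₂ = P′ +ₛ ι ½ *ₛ v

      Es-neg : ∀ a → Es z (-ₛ a) ≈ η a * e ((z -ₛ ι ½) *ₛ -ₛ a)
      Es-neg a = *-congʳ (η-neg a)

      F₁ : Bs x (-ₛ g) * Es z (-ₛ v) ≈ β g * η v * e d₁
      F₁ = trans (*-cong (Bs-neg x g) (Es-neg v)) (product
        (S.trans (S.+-cong (S.+-cong g≈ (S.-‿cong (S.*-congˡ g≈))) (S.*-congʳ (S.+-congʳ z≈)))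
          (S.solve 4 (λ x y u v → ((v S.:- u) S.:- x S.:* (v S.:- u)) S.:+ (S.:1 S.:- x S.:- y S.:- S.con ½) S.:* S.:- v
             S.:= ((y S.:- S.con ½) S.:* v S.:+ (x S.:- S.con ½) S.:* u) S.:+ v S.:- S.con ½ S.:* u) S.refl x y u v)))

      F₂ : Bs y g * Es z (-ₛ u) ≈ β g * η u * e d₂
      F₂ = trans (*-congˡ (Es-neg u)) (product
        (S.trans (S.+-cong (S.*-congˡ g≈) (S.*-congʳ (S.+-congʳ z≈)))
          (S.solve 4 (λ x y u v → y S.:* (v S.:- u) S.:+ (S.:1 S.:- x S.:- y S.:- S.con ½) S.:* S.:- u
             S.:= ((y S.:- S.con ½) S.:* v S.:+ (x S.:- S.con ½) S.:* u) S.:+ S.con ½ S.:* v) S.refl x y u v)))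

      F₃ : Es y v * Es x u ≈ η v * η u * e P′
      F₃ = product S.refl

-- Generating functions of the Bernoulli and Euler polynomials.

module GeneratingFunctions {c ℓ} (R : CommutativeRing c ℓ) (ι : ℚ → CommutativeRing.Carrier R) (ι-hom : IsQHom R ι) where
  open QAlgebra R ι ι-hom hiding (ring)
  open PowerSeries R
  open Powers R ι
  open Sums R ι
  open Scaling ℚring R ι ι-hom
  open Reason

  Bseries Eseries : Carrier → Series
  Bseries x = scale 1# bern ⊛ scale x invFact
  Eseries x = scale (ι ½) eul ⊛ scale (x - ι ½) invFact

  ι-term : ∀ {p q r s} → p ℚ.* q ≡ r ℚ.* s → ∀ t → ι p * (ι q * t) ≈ ι r * t * ι s
  ι-term {p} {q} {r} {s} eq t = begin
    ι p * (ι q * t)  ≈⟨ *-assoc _ _ _ ⟨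
    ι p * ι q * t    ≈⟨ *-congʳ (trans (sym (ι-* p q)) (trans (ι-≡ eq) (ι-* r s))) ⟩
    ι r * ι s * t    ≈⟨ solve 3 (λ r s t → r :* s :* t := r :* t :* s) refl _ _ _ ⟩
    ι r * t * ι s    ∎

  Bseries-coeff : ∀ x n → Bseries x n ≈ Bpoly R ι n x * ι (invFact n)
  Bseries-coeff x n = begin
    Bseries x n
      ≈⟨ ⊛-Σ _ _ n ⟩
    Σ< R ι (suc n) (λ k → ι (bern k) * pow R ι 1# k * (ι (invFact (n ∸ k)) * pow R ι x (n ∸ k)))
      ≈⟨ Σ-cong (suc n) (λ {k} k<1+n → trans (*-congʳ (trans (*-congˡ (pow-1 k)) (*-identityʳ _)))
                                              (ι-term (invFact-C (Bnum k) (ℕP.≤-pred k<1+n)) _)) ⟩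
    Σ< R ι (suc n) (λ k → ι (ℕ→ℚ (n C k) ℚ.* Bnum k) * pow R ι x (n ∸ k) * ι (invFact n))
      ≈⟨ Σ-*ʳ _ _ (suc n) ⟨
    Bpoly R ι n x * ι (invFact n) ∎

  pow-½ : ∀ n → pow R ι (ι ½) n ≈ ι (invPow2 n)
  pow-½ zero    = sym ι-1
  pow-½ (suc n) = trans (*-congʳ (pow-½ n)) (sym (ι-* _ _))

  Eseries-coeff : ∀ x n → Eseries x n ≈ Epoly R ι n x * ι (invFact n)
  Eseries-coeff x n = begin
    Eseries x n
      ≈⟨ ⊛-Σ _ _ n ⟩
    Σ< R ι (suc n) (λ k → ι (eul k) * pow R ι (ι ½) k * (ι (invFact (n ∸ k)) * pow R ι (x - ι ½) (n ∸ k)))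
      ≈⟨ Σ-cong (suc n) (λ {k} k<1+n → trans (*-congʳ (eul-½ k))
                                              (ι-term (invFact-C (Enum k ℚ.* invPow2 k) (ℕP.≤-pred k<1+n)) _)) ⟩
    Σ< R ι (suc n) (λ k → ι (ℕ→ℚ (n C k) ℚ.* (Enum k ℚ.* invPow2 k)) * pow R ι (x - ι ½) (n ∸ k) * ι (invFact n))
      ≈⟨ Σ-*ʳ _ _ (suc n) ⟨
    Epoly R ι n x * ι (invFact n) ∎
    where
    eul-½ : ∀ k → ι (eul k) * pow R ι (ι ½) k ≈ ι (Enum k ℚ.* invPow2 k ℚ.* invFact k)
    eul-½ k = begin
      ι (eul k) * pow R ι (ι ½) k                   ≈⟨ *-cong (ι-* _ _) (pow-½ k) ⟩
      ι (Enum k) * ι (invFact k) * ι (invPow2 k)    ≈⟨ solve 3 (λ a b c → a :* b :* c := a :* c :* b) refl _ _ _ ⟩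
      ι (Enum k) * ι (invPow2 k) * ι (invFact k)    ≈⟨ *-congʳ (ι-* (Enum k) (invPow2 k)) ⟨
      ι (Enum k ℚ.* invPow2 k) * ι (invFact k)      ≈⟨ ι-* (Enum k ℚ.* invPow2 k) (invFact k) ⟨
      ι (Enum k ℚ.* invPow2 k ℚ.* invFact k)        ∎

-- The linear functional on forms.

module Pairing {c ℓ} (R : CommutativeRing c ℓ) (ι : ℚ → CommutativeRing.Carrier R) (ι-hom : IsQHom R ι) where
  open QAlgebra R ι ι-hom hiding (ring)
  open PowerSeries R
  open Reason
  private
    module S = QAlgebra (PowerSeries.ring R) (const ∘ ι) (const∘-hom R ι ι-hom)
    ιS = const ∘ ι

  -- A polynomial f of degree at most n stands for the form of degree n in X and γ obtained by homogenising
  -- with γ; the pairing replaces γ^k X^j by φ k j.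
  pair : (ℕ → ℕ → Carrier) → Series → ℕ → Carrier
  pair φ f zero    = f 0 * φ 0 0
  pair φ f (suc n) = f 0 * φ (suc n) 0 + pair (λ k j → φ k (suc j)) (tail f) n

  pair-cong : ∀ φ {f g} n → (∀ k → f k ≈ g k) → pair φ f n ≈ pair φ g n
  pair-cong φ zero    p = *-congʳ (p 0)
  pair-cong φ (suc n) p = +-cong (*-congʳ (p 0)) (pair-cong _ n (λ k → p (suc k)))

  pair-+ : ∀ φ f g n → pair φ (f ⊕ g) n ≈ pair φ f n + pair φ g n
  pair-+ φ f g zero    = distribʳ _ _ _
  pair-+ φ f g (suc n) = trans (+-cong (distribʳ _ _ _) (pair-+ _ (tail f) (tail g) n))
    (solve 4 (λ a b c d → (a :+ b) :+ (c :+ d) := (a :+ c) :+ (b :+ d)) refl _ _ _ _)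

  pair-· : ∀ φ a f n → pair φ (a · f) n ≈ a * pair φ f n
  pair-· φ a f zero    = *-assoc _ _ _
  pair-· φ a f (suc n) = trans (+-cong (*-assoc _ _ _) (pair-· _ a (tail f) n)) (sym (distribˡ _ _ _))

  pair-0 : ∀ φ n → pair φ (λ _ → 0#) n ≈ 0#
  pair-0 φ zero    = zeroˡ _
  pair-0 φ (suc n) = trans (+-cong (zeroˡ _) (pair-0 _ n)) (+-identityˡ _)

  pair-X^ : ∀ φ j k → pair φ (pow (PowerSeries.ring R) ιS X j) (j ℕ.+ k) ≈ φ k j
  pair-X^ φ zero    zero    = *-identityˡ _
  pair-X^ φ zero    (suc k) = trans (+-cong (*-identityˡ _) (pair-0 _ k)) (+-identityʳ _)
  pair-X^ φ (suc j) k = begin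
    pair φ (Xʲ ⊛ X) (suc (j ℕ.+ k))
      ≈⟨ pair-cong φ (suc (j ℕ.+ k)) (⊛-comm-at Xʲ X) ⟩
    0# * Xʲ 0 * φ (suc (j ℕ.+ k)) 0 + pair φ′ (tail (X ⊛ Xʲ)) (j ℕ.+ k)
      ≈⟨ +-cong (trans (*-congʳ (zeroˡ _)) (zeroˡ _)) (trans (pair-cong φ′ (j ℕ.+ k) (X⊛ Xʲ)) (pair-X^ φ′ j k)) ⟩
    0# + φ k (suc j)
      ≈⟨ +-identityˡ _ ⟩
    φ k (suc j) ∎
    where
    Xʲ = pow (PowerSeries.ring R) ιS X j
    φ′ = λ k j → φ k (suc j)

module Functional {c ℓ} (R : CommutativeRing c ℓ) (ι : ℚ → CommutativeRing.Carrier R) (ι-hom : IsQHom R ι)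
  (p : ℕ) (r s t : CommutativeRing.Carrier R)
  (r+s+t≈p : CommutativeRing._≈_ R (CommutativeRing._+_ R (CommutativeRing._+_ R r s) t) (ι (ℕ→ℚ p))) where
  private
    S = PowerSeries.ring R
    module S = QAlgebra S (PowerSeries.const R ∘ ι) (const∘-hom R ι ι-hom)
  open QAlgebra R ι ι-hom hiding (ring)
  open PowerSeries R
  open Pairing R ι ι-hom
  open Powers S (const ∘ ι)
  open Reason
  private
    ιS = const ∘ ι
    module ΣR = Sums R ι
    module ΣS = Sums S ιS
  open Scaling R S ιS (const-hom R)

  -- Forms are dehomogenised at γ = 1: L only concerns the degree p + 1, from which the exponent of
  -- γ is recovered. Power series stand in for polynomials in u, as L reads only the coefficients up
  -- to p + 1.
  u v γ : Series
  u = X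
  γ = S.1#
  v = u S.+ γ

  φ : ℕ → ℕ → Carrier
  φ k j = falling R ι r k * falling R ι t j

  L : Series → Carrier
  L f = pair φ f (suc p)

  L-cong : ∀ {f g} → f ≋ g → L f ≈ L g
  L-cong eq = pair-cong φ (suc p) (at eq)

  L-+ : ∀ f g → L (f S.+ g) ≈ L f + L g
  L-+ f g = pair-+ φ f g (suc p)

  L-const : ∀ a f → L (const a S.* f) ≈ a * L f
  L-const a f = trans (pair-cong φ (suc p) (const-⊛ a f)) (pair-· φ a f (suc p))

  N-+ : ∀ m n → ι (ℕ→ℚ (m ℕ.+ n)) ≈ ι (ℕ→ℚ m) + ι (ℕ→ℚ n)
  N-+ m n = trans (ι-≡ (ℕ→ℚ-+ m n)) (ι-+ _ _)

  private
    infix 8 _^_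
    _^_ : Series → ℕ → Series
    _^_ = pow S ιS

    value : ℕ → ℕ → ℕ → Carrier
    value k m j = falling R ι r k * (sgn R ι m * falling R ι s m) * falling R ι t j

    -- Here r + s + t = p enters: with j + m + k = p it gives (t - j) + (r - k) = -(s - m), the next
    -- factor of ⟨s⟩ together with the change of sign.
    value-step : ∀ k m j → j ℕ.+ (m ℕ.+ k) ≡ p → value k m (suc j) + value (suc k) m j ≈ value k (suc m) j
    value-step k m j eq = begin
      fr * (σ * fs) * (ft * (t - n j)) + fr * (r - n k) * (σ * fs) * ft
        ≈⟨ solve 10 (λ fr σ fs ft r s t nj nk nm →
               fr :* (σ :* fs) :* (ft :* (t :- nj)) :+ fr :* (r :- nk) :* (σ :* fs) :* ft :=
               fr :* (σ :* fs) :* ft :* ((r :+ s :+ t) :- (nj :+ (nm :+ nk))) :+ fr :* (:- σ :* (fs :* (s :- nm))) :* ft)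
             refl fr σ fs ft r s t (n j) (n k) (n m) ⟩
      fr * (σ * fs) * ft * ((r + s + t) - (n j + (n m + n k))) + value k (suc m) j
        ≈⟨ +-congʳ (*-congˡ (+-congʳ (trans r+s+t≈p (trans (ι-≡ (≡.cong ℕ→ℚ (≡.sym eq)))
                                            (trans (N-+ j (m ℕ.+ k)) (+-congˡ (N-+ m k))))))) ⟩
      fr * (σ * fs) * ft * ((n j + (n m + n k)) - (n j + (n m + n k))) + value k (suc m) j
        ≈⟨ solve 3 (λ a b c → a :* (b :- b) :+ c := c) refl _ _ _ ⟩
      value k (suc m) j ∎
      where
      fr = falling R ι r k
      fs = falling R ι s m
      ft = falling R ι t j
      σ = sgn R ι m
      n : ℕ → Carrier
      n i = ι (ℕ→ℚ i)

    L-vu : ∀ m k j → j ℕ.+ (m ℕ.+ k) ≡ suc p → L (v ^ m S.* u ^ j) ≈ value k m j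
    L-vu zero k j eq = begin
      L (S.1# S.* u ^ j)
        ≈⟨ L-cong (S.*-identityˡ (u ^ j)) ⟩
      L (u ^ j)
        ≈⟨ reflexive (≡.cong (pair φ (u ^ j)) (≡.sym eq)) ⟩
      pair φ (u ^ j) (j ℕ.+ k)
        ≈⟨ pair-X^ φ j k ⟩
      falling R ι r k * falling R ι t j
        ≈⟨ solve 2 (λ a b → a :* b := a :* (:1 :* :1) :* b) refl _ _ ⟩
      value k 0 j ∎
    L-vu (suc m) k j eq = begin
      L (v ^ m S.* v S.* u ^ j)
        ≈⟨ L-cong (S.solve 3 (λ V U u → V S.:* (u S.:+ S.:1) S.:* U S.:= V S.:* (U S.:* u) S.:+ V S.:* U) S.refl (v ^ m) (u ^ j) u) ⟩
      L (v ^ m S.* u ^ suc j S.+ v ^ m S.* u ^ j)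
        ≈⟨ L-+ (v ^ m S.* u ^ suc j) (v ^ m S.* u ^ j) ⟩
      L (v ^ m S.* u ^ suc j) + L (v ^ m S.* u ^ j)
        -- The second summand carries an invisible factor γ = 1, so its exponent k rises by one and
        -- the degree stays p + 1.
        ≈⟨ +-cong (L-vu m k (suc j) (≡.cong suc eq′)) (L-vu m (suc k) j (≡.trans (≡.cong (j ℕ.+_) (ℕP.+-suc m k)) eq)) ⟩
      value k m (suc j) + value (suc k) m j
        ≈⟨ value-step k m j eq′ ⟩
      value k (suc m) j ∎
      where
      eq′ : j ℕ.+ (m ℕ.+ k) ≡ p
      eq′ = ℕP.suc-injective (≡.trans (≡.sym (ℕP.+-suc j (m ℕ.+ k))) eq)

  L-monomial : ∀ k m j → j ℕ.+ (m ℕ.+ k) ≡ suc p → L (γ ^ k S.* (v ^ m S.* u ^ j)) ≈ value k m j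
  L-monomial k m j eq = trans (L-cong (S.trans (S.*-congʳ (pow-1 k)) (S.*-identityˡ _))) (L-vu m k j eq)

  L-Σ : ∀ a f n → L (a S.* Σ< S ιS n f) ≈ Σ< R ι n (λ k → L (a S.* f k))
  L-Σ a f zero    = trans (L-cong (S.zeroʳ a)) (pair-0 φ (suc p))
  L-Σ a f (suc n) = trans (L-cong (S.distribˡ a (Σ< S ιS n f) (f n)))
   (trans (L-+ (a S.* Σ< S ιS n f) (a S.* f n)) (+-congʳ (L-Σ a f n)))

  -- The factorials in the denominators of f and g turn the falling factorials produced by L into
  -- binomial coefficients. The last hypothesis isolates what differs between the six products: the
  -- value of L on c a^k b^j, with scalar `w`.
  L-convolution : ∀ {f g : Series} {F G : ℕ → Carrier} {a b : Series} {w α β : Carrier} c n →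
    (∀ k → f k ≈ F k * ι (invFact k)) → (∀ k → g k ≈ G k * ι (invFact k)) →
    (∀ k j → k ℕ.+ j ≡ n → L (c S.* (a ^ k S.* b ^ j)) ≈ w * (sgn R ι k * falling R ι α k * falling R ι β j)) →
    L (c S.* PowerSeries._⊛_ S (scale a f) (scale b g) n) ≈
    w * Σ< R ι (suc n) (λ k → sgn R ι k * binom R ι α k * binom R ι β (n ∸ k) * F k * G (n ∸ k))
  L-convolution {f} {g} {F} {G} {a} {b} {w} {α} {β} c n f≈ g≈ eq = begin
    L (c S.* PowerSeries._⊛_ S (scale a f) (scale b g) n)
      ≈⟨ L-cong (S.*-congˡ {x = c} (ΣS.⊛-Σ (scale a f) (scale b g) n)) ⟩
    L (c S.* Σ< S ιS (suc n) (λ k → scale a f k S.* scale b g (n ∸ k)))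
      ≈⟨ L-Σ c _ (suc n) ⟩
    Σ< R ι (suc n) (λ k → L (c S.* (scale a f k S.* scale b g (n ∸ k))))
      ≈⟨ ΣR.Σ-cong (suc n) (λ {k} k<1+n → term k (n ∸ k) (ℕP.m+[n∸m]≡n (ℕP.≤-pred k<1+n))) ⟩
    Σ< R ι (suc n) (λ k → w * (sgn R ι k * binom R ι α k * binom R ι β (n ∸ k) * F k * G (n ∸ k)))
      ≈⟨ ΣR.Σ-*ˡ w _ (suc n) ⟨
    w * Σ< R ι (suc n) (λ k → sgn R ι k * binom R ι α k * binom R ι β (n ∸ k) * F k * G (n ∸ k)) ∎
    where
    term : ∀ k j → k ℕ.+ j ≡ n → L (c S.* (scale a f k S.* scale b g j)) ≈
           w * (sgn R ι k * binom R ι α k * binom R ι β j * F k * G j)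
    term k j k+j≡n = begin
      L (c S.* ((const (f k) S.* a ^ k) S.* (const (g j) S.* b ^ j)))
        ≈⟨ L-cong (S.solve 5 (λ c x A y B → c S.:* ((x S.:* A) S.:* (y S.:* B)) S.:= x S.:* (y S.:* (c S.:* (A S.:* B)))) S.refl
             c (const (f k)) (a ^ k) (const (g j)) (b ^ j)) ⟩
      L (const (f k) S.* (const (g j) S.* (c S.* (a ^ k S.* b ^ j))))
        ≈⟨ trans (L-const (f k) _) (*-congˡ (L-const (g j) _)) ⟩
      f k * (g j * L (c S.* (a ^ k S.* b ^ j)))
        ≈⟨ *-cong (f≈ k) (*-cong (g≈ j) (eq k j k+j≡n)) ⟩
      F k * ι (invFact k) * (G j * ι (invFact j) * (w * (sgn R ι k * falling R ι α k * falling R ι β j)))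
        ≈⟨ solve 8 (λ F i G j w σ x y → F :* i :* (G :* j :* (w :* (σ :* x :* y))) := w :* (σ :* (x :* i) :* (y :* j) :* F :* G)) refl
             (F k) (ι (invFact k)) (G j) (ι (invFact j)) w (sgn R ι k) (falling R ι α k) (falling R ι β j) ⟩
      w * (sgn R ι k * binom R ι α k * binom R ι β j * F k * G j) ∎

-- From the relations between series to the identities between sums.

module Proof {c ℓ} (R : CommutativeRing c ℓ) (ι : ℚ → CommutativeRing.Carrier R) (ι-hom : IsQHom R ι) where
  open QAlgebra R ι ι-hom hiding (ring)
  open PowerSeries R using (Series; const; at)
  open GeneratingFunctions R ι ι-hom
  open Reason
  private
    S = PowerSeries.ring R
    ιS = const ∘ ι
    ιS-hom = const∘-hom R ι ι-hom
    module S = QAlgebra S ιS ιS-hom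
    module Y = Symmetry S ιS ιS-hom
    module PS = PowerSeries S
    module Sums-R = Sums R ι
    infix 8 _^_
    _^_ : Series → ℕ → Series
    _^_ = pow S ιS
  open RingMorphisms.IsRingHomomorphism (const-hom R) using () renaming (⟦⟧-cong to const-cong; +-homo to const-+; *-homo to const-*; -‿homo to const-neg)
  open Scaling R S ιS (const-hom R) using (scale; scale-⊛)
  open ScaleComposition R S ι ι-hom (const-hom R) ιS-hom using (scale-scale)
  open Powers S ιS using (pow-neg)

  -- Displays the coefficient of w^n as a constant times a^n, the form on which L can be evaluated.
  scale-Bseries : ∀ x a → Y.Bs (const x) a Y.T.≈ scale a (Bseries x)
  scale-Bseries x a = Y.T.sym (Y.T.trans (scale-⊛ a _ _)
    (Y.T.*-cong (Y.T.trans (scale-scale a 1# bern) (Y.scale-cong (S.*-identityˡ a) (CommutativeRing.refl (PowerSeries.ring ℚring))))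
                (scale-scale a x invFact)))

  scale-Eseries : ∀ x a → Y.Es (const x) a Y.T.≈ scale a (Eseries x)
  scale-Eseries x a = Y.T.sym (Y.T.trans (scale-⊛ a _ _)
    (Y.T.*-cong (scale-scale a (ι ½) eul)
                (Y.T.trans (scale-scale a (x - ι ½) invFact)
                           (Y.e-cong (S.*-congʳ (S.trans (const-+ x (- ι ½)) (S.+-congˡ (const-neg (ι ½)))))))))

  sgn-const : ∀ n → sgn S ιS n S.≈ const (sgn R ι n)
  sgn-const zero    = S.refl
  sgn-const (suc n) = S.trans (S.-‿cong (sgn-const n)) (S.sym (const-neg (sgn R ι n)))

  sgn-+ : ∀ m n → sgn R ι (m ℕ.+ n) ≈ sgn R ι m * sgn R ι n
  sgn-+ zero    n = sym (*-identityˡ _)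
  sgn-+ (suc m) n = trans (-‿cong (sgn-+ m n)) (solve 2 (λ x y → :- (x :* y) := :- x :* y) refl _ _)

  sgn² : ∀ n → sgn R ι n * sgn R ι n ≈ 1#
  sgn² zero    = *-identityˡ _
  sgn² (suc n) = trans (solve 1 (λ x → :- x :* :- x := x :* x) refl _) (sgn² n)

  falling-1 : ∀ a → falling R ι a 1 ≈ a
  falling-1 a = solve 1 (λ a → :1 :* (a :- con 0ℚ) := a) refl a

  pow-neg-const : ∀ a k → (S.- a) ^ k S.≈ const (sgn R ι k) S.* a ^ k
  pow-neg-const a k = S.trans (pow-neg a k) (S.*-congʳ (sgn-const k))

  module Relation (p : ℕ) (x y z r s t : Carrier) (x+y+z≈1 : x + y + z ≈ 1#) (r+s+t≈p : r + s + t ≈ ι (ℕ→ℚ p)) where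
    open Functional R ι ι-hom p r s t r+s+t≈p
    private
      σ : ℕ → Carrier
      σ = sgn R ι
      _⟨_⟩ : Carrier → ℕ → Carrier
      _⟨_⟩ = falling R ι

    const-x+y+z≈1 : const x S.+ const y S.+ const z S.≈ S.1#
    const-x+y+z≈1 = S.trans (S.sym (S.trans (const-+ (x + y) z) (S.+-congʳ (const-+ x y)))) (const-cong x+y+z≈1)

    L-multiple : ∀ {f} a k m j → f S.≈ const a S.* (γ ^ k S.* (v ^ m S.* u ^ j)) → j ℕ.+ (m ℕ.+ k) ≡ suc p →
      L f ≈ a * (r ⟨ k ⟩ * (σ m * s ⟨ m ⟩) * t ⟨ j ⟩)
    L-multiple a k m j f≈ eq = trans (L-cong f≈) (trans (L-const a _) (*-congˡ (L-monomial k m j eq)))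

    -- The sign of (-v)^j cancels the sign that L attaches to v^j, so only that of (-γ)^k survives.
    -- Part (i) takes d = 0; part (ii) takes d = 1, for the factor u in front.
    L-γ-v : ∀ d k j → j ℕ.+ k ℕ.+ d ≡ suc p →
      L (u ^ d S.* ((S.- γ) ^ k S.* (S.- v) ^ j)) ≈ t ⟨ d ⟩ * (σ k * r ⟨ k ⟩ * s ⟨ j ⟩)
    L-γ-v d k j eq = begin
      L (u ^ d S.* ((S.- γ) ^ k S.* (S.- v) ^ j))
        ≈⟨ L-multiple (σ k * σ j) k j d
             (S.trans (S.*-congˡ (S.*-cong (pow-neg-const γ k) (pow-neg-const v j)))
             (S.trans (S.solve 5 (λ U a b G V → U S.:* ((a S.:* G) S.:* (b S.:* V)) S.:= (a S.:* b) S.:* (G S.:* (V S.:* U))) S.refl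
                        (u ^ d) (const (σ k)) (const (σ j)) (γ ^ k) (v ^ j))
                      (S.*-congʳ (S.sym (const-* (σ k) (σ j))))))
             (≡.trans (ℕP.+-comm d (j ℕ.+ k)) eq) ⟩
      σ k * σ j * (r ⟨ k ⟩ * (σ j * s ⟨ j ⟩) * t ⟨ d ⟩)
        ≈⟨ solve 5 (λ a b x y z → a :* b :* (x :* (b :* y) :* z) := b :* b :* (z :* (a :* x :* y))) refl
             (σ k) (σ j) (r ⟨ k ⟩) (s ⟨ j ⟩) (t ⟨ d ⟩) ⟩
      σ j * σ j * (t ⟨ d ⟩ * (σ k * r ⟨ k ⟩ * s ⟨ j ⟩))
        ≈⟨ trans (*-congʳ (sgn² j)) (*-identityˡ _) ⟩
      t ⟨ d ⟩ * (σ k * r ⟨ k ⟩ * s ⟨ j ⟩) ∎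

    -- Only (-u)^j brings a sign, and (-1)^j = (-1)^(k+j) (-1)^k. This is the origin of the factor
    -- (-1)^n before the second sum of (i).
    L-γ-u : ∀ k j → k ℕ.+ j ≡ suc p →
      L (S.1# S.* (γ ^ k S.* (S.- u) ^ j)) ≈ σ (suc p) * (σ k * r ⟨ k ⟩ * t ⟨ j ⟩)
    L-γ-u k j eq = begin
      L (S.1# S.* (γ ^ k S.* (S.- u) ^ j))
        ≈⟨ L-multiple (σ j) k 0 j
             (S.trans (S.*-congˡ (S.*-congˡ (pow-neg-const u j)))
                      (S.solve 3 (λ a G U → S.:1 S.:* (G S.:* (a S.:* U)) S.:= a S.:* (G S.:* (S.:1 S.:* U))) S.refl
                        (const (σ j)) (γ ^ k) (u ^ j)))
             (≡.trans (ℕP.+-comm j k) eq) ⟩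
      σ j * (r ⟨ k ⟩ * (1# * 1#) * t ⟨ j ⟩)
        ≈⟨ trans (sym (*-identityˡ _)) (*-congʳ (sym (sgn² k))) ⟩
      σ k * σ k * (σ j * (r ⟨ k ⟩ * (1# * 1#) * t ⟨ j ⟩))
        ≈⟨ solve 4 (λ a b x y → a :* a :* (b :* (x :* (:1 :* :1) :* y)) := a :* b :* (a :* x :* y)) refl
             (σ k) (σ j) (r ⟨ k ⟩) (t ⟨ j ⟩) ⟩
      σ k * σ j * (σ k * r ⟨ k ⟩ * t ⟨ j ⟩)
        ≈⟨ *-congʳ (trans (sym (sgn-+ k j)) (reflexive (≡.cong σ eq))) ⟩
      σ (suc p) * (σ k * r ⟨ k ⟩ * t ⟨ j ⟩) ∎

    -- The extra γ raises the degree from p to p + 1 and contributes ⟨r⟩_1 = r. The scalar a is ½ in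
    -- (i) and 1 in (ii).
    L-v-u : ∀ a k j → k ℕ.+ j ≡ p →
      L (const a S.* γ S.* (v ^ k S.* u ^ j)) ≈ r * a * (σ k * s ⟨ k ⟩ * t ⟨ j ⟩)
    L-v-u a k j eq = begin
      L (const a S.* γ S.* (v ^ k S.* u ^ j))
        ≈⟨ L-multiple a 1 k j
             (S.solve 4 (λ a g V U → a S.:* g S.:* (V S.:* U) S.:= a S.:* ((S.:1 S.:* g) S.:* (V S.:* U))) S.refl (const a) γ (v ^ k) (u ^ j))
             (≡.trans (≡.cong (j ℕ.+_) (ℕP.+-comm k 1)) (≡.trans (ℕP.+-suc j k) (≡.cong suc (≡.trans (ℕP.+-comm j k) eq)))) ⟩
      a * (r ⟨ 1 ⟩ * (σ k * s ⟨ k ⟩) * t ⟨ j ⟩)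
        ≈⟨ *-congˡ (*-congʳ (*-congʳ (falling-1 r))) ⟩
      a * (r * (σ k * s ⟨ k ⟩) * t ⟨ j ⟩)
        ≈⟨ solve 5 (λ a r b x y → a :* (r :* (b :* x) :* y) := r :* a :* (b :* x :* y)) refl a r (σ k) (s ⟨ k ⟩) (t ⟨ j ⟩) ⟩
      r * a * (σ k * s ⟨ k ⟩ * t ⟨ j ⟩) ∎

    -- The extra v contributes -⟨s⟩_1 = -s; this minus sign makes the three terms of (ii) add up to
    -- zero.
    L-u-γ : ∀ k j → k ℕ.+ j ≡ p →
      L (v S.* ((S.- u) ^ k S.* γ ^ j)) ≈ - s * (σ k * t ⟨ k ⟩ * r ⟨ j ⟩)
    L-u-γ k j eq = begin
      L (v S.* ((S.- u) ^ k S.* γ ^ j))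
        ≈⟨ L-multiple (σ k) j 1 k
             (S.trans (S.*-congˡ (S.*-congʳ (pow-neg-const u k)))
                      (S.solve 4 (λ a v U G → v S.:* ((a S.:* U) S.:* G) S.:= a S.:* (G S.:* ((S.:1 S.:* v) S.:* U))) S.refl
                        (const (σ k)) v (u ^ k) (γ ^ j)))
             (≡.trans (ℕP.+-suc k j) (≡.cong suc eq)) ⟩
      σ k * (r ⟨ j ⟩ * (- 1# * s ⟨ 1 ⟩) * t ⟨ k ⟩)
        ≈⟨ *-congˡ (*-congʳ (*-congˡ (*-congˡ (falling-1 s)))) ⟩
      σ k * (r ⟨ j ⟩ * (- 1# * s) * t ⟨ k ⟩)
        ≈⟨ solve 4 (λ a x s y → a :* (x :* (:- :1 :* s) :* y) := :- s :* (a :* y :* x)) refl (σ k) (r ⟨ j ⟩) s (t ⟨ k ⟩) ⟩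
      - s * (σ k * t ⟨ k ⟩ * r ⟨ j ⟩) ∎

    B E : ℕ → Carrier → Carrier
    B = Bpoly R ι
    E = Epoly R ι

    sum : Carrier → Carrier → (ℕ → Carrier) → (ℕ → Carrier) → ℕ → Carrier
    sum a b F G n = Σ< R ι (suc n) (λ k → σ k * binom R ι a k * binom R ι b (n ∸ k) * F k * G (n ∸ k))

    Bernoulli-Euler-sums :
      sum r s (λ k → B k x) (λ k → E k z) (suc p) - σ (suc p) * sum r t (λ k → B k y) (λ k → E k z) (suc p)
      ≈ r * ι ½ * sum s t (λ k → E k y) (λ k → E k x) p
    Bernoulli-Euler-sums = begin
      S₁ - σ (suc p) * S₂
        ≈⟨ +-congʳ S₁≈ ⟩
      σ (suc p) * S₂ + r * ι ½ * S₃ - σ (suc p) * S₂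
        ≈⟨ solve 2 (λ a b → a :+ b :- a := b) refl _ _ ⟩
      r * ι ½ * S₃ ∎
      where
      S₁ = sum r s (λ k → B k x) (λ k → E k z) (suc p)
      S₂ = sum r t (λ k → B k y) (λ k → E k z) (suc p)
      S₃ = sum s t (λ k → E k y) (λ k → E k x) p

      W₂ = S.1# S.* (scale γ (Bseries y) PS.⊛ scale (S.- u) (Eseries z)) (suc p)
      W₃ = ιS ½ S.* γ S.* (scale v (Eseries y) PS.⊛ scale u (Eseries x)) p

      relation : (scale (S.- γ) (Bseries x) PS.⊛ scale (S.- v) (Eseries z)) (suc p) S.≈
        (scale γ (Bseries y) PS.⊛ scale (S.- u) (Eseries z)) (suc p) S.+
        ιS ½ S.* γ S.* (scale v (Eseries y) PS.⊛ scale u (Eseries x)) p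
      relation = S.trans
        (PS.at (Y.T.trans (Y.T.sym (Y.T.*-cong (scale-Bseries x (S.- γ)) (scale-Eseries z (S.- v))))
               (Y.T.trans (Y.Bernoulli-Euler (const x) (const y) (const z) u v γ const-x+y+z≈1 S.refl)
                 (Y.T.+-cong (Y.T.*-cong (scale-Bseries y γ) (scale-Eseries z (S.- u)))
                   (Y.T.*-congˡ (Y.T.*-congˡ (Y.T.*-cong (scale-Eseries y v) (scale-Eseries x u)))))))
          (suc p))
        -- The factor w in the last term lowers its index to p, hence the sum of length n - 1 + 1 on
        -- the right of (i).
        (S.+-congˡ (S.trans (PS.X⊛ _ p) (PS.const-⊛ _ _ p)))

      S₁≈ : S₁ ≈ σ (suc p) * S₂ + r * ι ½ * S₃
      S₁≈ = begin
        S₁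
          ≈⟨ *-identityˡ _ ⟨
        1# * S₁
          ≈⟨ L-convolution S.1# (suc p) (Bseries-coeff x) (Eseries-coeff z)
               (λ k j eq → L-γ-v 0 k j (≡.trans (ℕP.+-identityʳ _) (≡.trans (ℕP.+-comm j k) eq))) ⟨
        L (S.1# S.* (scale (S.- γ) (Bseries x) PS.⊛ scale (S.- v) (Eseries z)) (suc p))
          ≈⟨ L-cong (S.trans (S.*-identityˡ _) (S.trans relation (S.+-congʳ {x = W₃} (S.sym (S.*-identityˡ _))))) ⟩
        L (W₂ S.+ W₃)
          ≈⟨ L-+ W₂ W₃ ⟩
        L W₂ + L W₃
          ≈⟨ +-cong (L-convolution S.1# (suc p) (Bseries-coeff y) (Eseries-coeff z) L-γ-u)
                    (L-convolution (ιS ½ S.* γ) p (Eseries-coeff y) (Eseries-coeff x) (L-v-u (ι ½))) ⟩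
        σ (suc p) * S₂ + r * ι ½ * S₃ ∎

    Bernoulli-sums : r * M R ι p s t x y + s * M R ι p t r y z + t * M R ι p r s z x ≈ 0#
    Bernoulli-sums = begin
      r * M R ι p s t x y + s * M R ι p t r y z + t * M R ι p r s z x
        ≈⟨ +-cong (+-cong (*-congˡ (M≈ s t x y)) (*-congˡ (M≈ t r y z))) (*-congˡ (M≈ r s z x)) ⟩
      r * M₁ + s * M₂ + t * M₃
        ≈⟨ solve 4 (λ a s b c → a :+ s :* b :+ c := (a :+ c) :- (:- s :* b)) refl (r * M₁) s M₂ (t * M₃) ⟩
      (r * M₁ + t * M₃) - (- s * M₂)
        ≈⟨ +-congʳ combined ⟩
      - s * M₂ - (- s * M₂)
        ≈⟨ -‿inverseʳ _ ⟩
      0# ∎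
      where
      M₁ = sum s t (λ k → B k y) (λ k → B k x) p
      M₂ = sum t r (λ k → B k z) (λ k → B k y) p
      M₃ = sum r s (λ k → B k x) (λ k → B k z) p

      M≈ : ∀ a b c d → M R ι p a b c d ≈ sum a b (λ k → B k d) (λ k → B k c) p
      M≈ a b c d = Sums-R.Σ-cong (suc p) (λ _ → solve 3 (λ e f g → e :* f :* g := e :* g :* f) refl _ _ _)

      combined : r * M₁ + t * M₃ ≈ - s * M₂
      combined = begin
        r * M₁ + t * M₃
          ≈⟨ +-cong (*-congʳ (*-identityʳ r)) (*-congʳ (falling-1 t)) ⟨
        r * 1# * M₁ + t ⟨ 1 ⟩ * M₃
          ≈⟨ +-cong (L-convolution (const 1# S.* γ) p (Bseries-coeff y) (Bseries-coeff x) (L-v-u 1#))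
                    (L-convolution (u ^ 1) p (Bseries-coeff x) (Bseries-coeff z)
                      (λ k j eq → L-γ-v 1 k j (≡.trans (ℕP.+-comm _ 1) (≡.cong suc (≡.trans (ℕP.+-comm j k) eq))))) ⟨
        L W₁ + L W₃
          ≈⟨ L-+ W₁ W₃ ⟨
        L (W₁ S.+ W₃)
          ≈⟨ L-cong (S.trans (S.+-cong (S.*-congʳ (S.*-identityˡ γ)) (S.*-congʳ (S.*-identityˡ u))) relation) ⟩
        L (v S.* (scale (S.- u) (Bseries z) PS.⊛ scale γ (Bseries y)) p)
          ≈⟨ L-convolution v p (Bseries-coeff z) (Bseries-coeff y) L-u-γ ⟩
        - s * M₂ ∎
        where
        W₁ = const 1# S.* γ S.* (scale v (Bseries y) PS.⊛ scale u (Bseries x)) p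
        W₃ = u ^ 1 S.* (scale (S.- γ) (Bseries x) PS.⊛ scale (S.- v) (Bseries z)) p

        relation : γ S.* (scale v (Bseries y) PS.⊛ scale u (Bseries x)) p S.+
                   u S.* (scale (S.- γ) (Bseries x) PS.⊛ scale (S.- v) (Bseries z)) p S.≈
                   v S.* (scale (S.- u) (Bseries z) PS.⊛ scale γ (Bseries y)) p
        relation = S.trans (S.+-cong (S.sym (PS.const-⊛ γ _ p)) (S.sym (PS.const-⊛ u _ p)))
          (S.trans (PS.at (Y.T.trans
              (Y.T.sym (Y.T.+-cong (Y.T.*-congˡ (Y.T.*-cong (scale-Bseries y v) (scale-Bseries x u)))
                                   (Y.T.*-congˡ (Y.T.*-cong (scale-Bseries x (S.- γ)) (scale-Bseries z (S.- v))))))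
              (Y.T.trans (Y.three-Bernoulli (const x) (const y) (const z) u v γ const-x+y+z≈1 S.refl)
                         (Y.T.*-congˡ (Y.T.*-cong (scale-Bseries z (S.- u)) (scale-Bseries y γ)))))
            p)
          (PS.const-⊛ v _ p))

theorem1p1 : ∀ {c ℓ} (R : CommutativeRing c ℓ) (ι : ℚ → CommutativeRing.Carrier R) → IsQHom R ι →
    let open CommutativeRing R in
    (n : ℕ) → 1 ≤ n → (x y z : Carrier) → x + y + z ≈ 1# →
    (∀ (r s t : Carrier) → r + s + t ≈ ι (ℕ→ℚ (n ∸ 1)) →
    Σ< R ι (suc n) (λ k → sgn R ι k * binom R ι r k * binom R ι s (n ∸ k) * Bpoly R ι k x * Epoly R ι (n ∸ k) z)
    - sgn R ι n * Σ< R ι (suc n) (λ k → sgn R ι k * binom R ι r k * binom R ι t (n ∸ k) * Bpoly R ι k y * Epoly R ι (n ∸ k) z)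
    ≈ r * ι (+ 1 ℚ./ 2) * Σ< R ι n (λ l → sgn R ι l * binom R ι s l * binom R ι t (n ∸ 1 ∸ l) * Epoly R ι l y * Epoly R ι (n ∸ 1 ∸ l) x))
    ×
    (∀ (r s t : Carrier) → r + s + t ≈ ι (ℕ→ℚ n) →
    r * M R ι n s t x y + s * M R ι n t r y z + t * M R ι n r s z x ≈ 0#)
theorem1p1 R ι ι-hom (suc p) (s≤s z≤n) x y z x+y+z≈1 =
  -- The first argument of each call is the value of r + s + t, which is n - 1 = p in (i) and n = p
  -- + 1 in (ii).
  (λ r s t r+s+t≈p → Relation.Bernoulli-Euler-sums p x y z r s t x+y+z≈1 r+s+t≈p) ,
  (λ r s t r+s+t≈n → Relation.Bernoulli-sums (suc p) x y z r s t x+y+z≈1 r+s+t≈n)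
  where open Proof R ι ι-hom
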